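{- Let $G$ be a connected (finite, simple) graph. Then $G$ is (claw, bull)-free if and only if it belongs to one of the following (disjoint) classes of graphs: (i) the class of graphs which are expansions of paths of length at least four; (ii) the class of graphs which are expansions of cycles of length at least six; (iii) the class of connected graphs which are complements of triangle-free graphs.
   Context: A claw is a graph isomorphic to $K_{1,3}$. A bull is the graph obtained from a triangle by adding two pendant edges at two different vertices (so it has 5 vertices and 5 edges). A graph is (claw, bull)-free if it has no induced subgraph isomorphic to a claw or to a bull. An expansion of a graph $F$ with vertex set $\{v_1,\dots,v_n\}$ is any graph $H$ obtained from $F$ by replacing each vertex $v_i$ by a nonempty clique $K^{[i]}$, the cliques being pairwise vertex-disjoint, and adding all edges between $V(K^{[i]})$ and $V(K^{[j]})$ whenever $v_iv_j\in E(F)$ (and no other edges between different cliques). The length of a path is its number of edges. -}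

module Defs where

open import Data.Fin.Base using (Fin; toℕ)
open import Data.Fin.Patterns using (0F; 1F; 2F; 3F; 4F)
import Data.Fin.Properties as Fin
open import Data.List.Base using (List; []; _∷_)
import Data.List.Membership.DecPropositional as DecMembership
open import Data.List.Relation.Unary.All using (All; lookup; all?)
open import Data.Nat.Base using (ℕ; suc; _≤_; s≤s)
import Data.Nat.Properties as ℕ
open import Data.Product.Base using (Σ-syntax; ∃-syntax; _×_; _,_; proj₁; proj₂)
open import Data.Product.Properties using (≡-dec)
open import Data.Sum.Base using (_⊎_; inj₁; inj₂; swap; [_,_])
open import Function.Bundles using (_⇔_; _↔_; Inverse)
open import Function.Definitions using (Injective)
open import Level using (0ℓ)
open import Relation.Binary.Construct.Closure.ReflexiveTransitive using (Star)
open import Relation.Binary.Core using (Rel)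
open import Relation.Binary.Definitions using (Decidable; Symmetric; Irreflexive)
open import Relation.Binary.PropositionalEquality using (_≡_; _≢_; refl; sym; ≢-sym)
open import Relation.Nullary.Decidable using (from-yes; ¬?; _×-dec_; _⊎-dec_)
open import Relation.Nullary.Negation using (¬_)
open import Relation.Unary using (Pred)

-- Finite simple graphs.  Adjacency is required to be decidable, so a graph
-- carries the same data as a 0/1 adjacency matrix.
record Graph : Set₁ where
  field
    order      : ℕ
    Adj        : Rel (Fin order) 0ℓ
    adj?       : Decidable Adj
    adj-sym    : Symmetric Adj
    adj-irrefl : Irreflexive _≡_ Adj

  Vertex : Set
  Vertex = Fin order

open Graph public using (Vertex; Adj)

symmetrise : ∀ {n} (R : Rel (Fin n) 0ℓ) → Decidable R → Irreflexive _≡_ R → Graph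
symmetrise {n} R R? R-irrefl = record
  { order      = n
  ; Adj        = λ i j → R i j ⊎ R j i
  ; adj?       = λ i j → R? i j ⊎-dec R? j i
  ; adj-sym    = swap
  ; adj-irrefl = λ i≡j → [ R-irrefl i≡j , R-irrefl (sym i≡j) ]
  }

fromEdges : ∀ n (es : List (Fin n × Fin n)) → All (λ e → proj₁ e ≢ proj₂ e) es → Graph
fromEdges n es loopless =
  symmetrise (λ i j → (i , j) ∈ es) (λ i j → (i , j) ∈? es)
             (λ { refl e∈es → lookup loopless e∈es refl })
  where open DecMembership (≡-dec (Fin._≟_ {n}) (Fin._≟_ {n})) using (_∈_; _∈?_)

triangle : Graph
triangle = fromEdges 3 es (from-yes (all? (λ e → ¬? (proj₁ e Fin.≟ proj₂ e)) es))
  where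
  es : List (Fin 3 × Fin 3)
  es = (0F , 1F) ∷ (1F , 2F) ∷ (0F , 2F) ∷ []

claw : Graph
claw = fromEdges 4 es (from-yes (all? (λ e → ¬? (proj₁ e Fin.≟ proj₂ e)) es))
  where
  es : List (Fin 4 × Fin 4)
  es = (0F , 1F) ∷ (0F , 2F) ∷ (0F , 3F) ∷ []

bull : Graph
bull = fromEdges 5 es (from-yes (all? (λ e → ¬? (proj₁ e Fin.≟ proj₂ e)) es))
  where
  es : List (Fin 5 × Fin 5)
  es = (0F , 1F) ∷ (1F , 2F) ∷ (0F , 2F) ∷ (0F , 3F) ∷ (1F , 4F) ∷ []

-- The length is the number of edges, so path k has suc k vertices.
path : ℕ → Graph
path k = symmetrise {suc k} (λ i j → toℕ j ≡ suc (toℕ i))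
                            (λ i j → toℕ j ℕ.≟ suc (toℕ i))
                            (λ { refl i≡1+i → ℕ.1+n≢n (sym i≡1+i) })

cycle : ∀ k → 3 ≤ k → Graph
cycle k 3≤k = symmetrise {k} R R? R-irrefl
  where
  R : Rel (Fin k) 0ℓ
  R i j = toℕ j ≡ suc (toℕ i) ⊎ (suc (toℕ i) ≡ k × toℕ j ≡ 0)

  R? : Decidable R
  R? i j = (toℕ j ℕ.≟ suc (toℕ i)) ⊎-dec ((suc (toℕ i) ℕ.≟ k) ×-dec (toℕ j ℕ.≟ 0))

  no-loop : ∀ {k m} → 3 ≤ k → suc m ≡ k → m ≢ 0
  no-loop (s≤s ()) refl refl

  R-irrefl : Irreflexive _≡_ R
  R-irrefl refl (inj₁ i≡1+i)         = ℕ.1+n≢n (sym i≡1+i)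
  R-irrefl refl (inj₂ (1+i≡k , i≡0)) = no-loop 3≤k 1+i≡k i≡0

complement : Graph → Graph
complement G = record
  { order      = order
  ; Adj        = λ u v → u ≢ v × ¬ Graph.Adj G u v
  ; adj?       = λ u v → ¬? (u Fin.≟ v) ×-dec ¬? (adj? u v)
  ; adj-sym    = λ (u≢v , u≁v) → ≢-sym u≢v , λ v~u → u≁v (adj-sym v~u)
  ; adj-irrefl = λ u≡v (u≢v , _) → u≢v u≡v
  }
  where open Graph G using (order; adj?; adj-sym)

infix 4 _≅_

_≅_ : Rel Graph 0ℓ
G ≅ H = Σ[ φ ∈ Vertex G ↔ Vertex H ]
        (∀ u v → Adj G u v ⇔ Adj H (Inverse.to φ u) (Inverse.to φ v))

-- An induced subgraph of G isomorphic to F is the image of such an f.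
HasInduced : Graph → Pred Graph 0ℓ
HasInduced F G = Σ[ f ∈ (Vertex F → Vertex G) ]
  (Injective _≡_ _≡_ f × (∀ i j → Adj F i j ⇔ Adj G (f i) (f j)))

ClawBullFree : Pred Graph 0ℓ
ClawBullFree G = ¬ HasInduced claw G × ¬ HasInduced bull G

-- Triangles are complete, so every triangle subgraph is induced.
TriangleFree : Pred Graph 0ℓ
TriangleFree G = ¬ HasInduced triangle G

Connected : Pred Graph 0ℓ
Connected G = Vertex G × (∀ u v → Star (Adj G) u v)

-- The clique replacing the vertex i of F is the fibre of bag over i.
record IsExpansionOf (F G : Graph) : Set where
  field
    bag      : Vertex G → Vertex F
    nonempty : ∀ i → ∃[ v ] bag v ≡ i
    clique   : ∀ {u v} → bag u ≡ bag v → u ≢ v → Adj G u v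
    joined   : ∀ {u v} → Adj F (bag u) (bag v) → Adj G u v
    no-other : ∀ {u v} → bag u ≢ bag v → Adj G u v → Adj F (bag u) (bag v)

ExpansionOfLongPath : Pred Graph 0ℓ
ExpansionOfLongPath G = ∃[ k ] (4 ≤ k × IsExpansionOf (path k) G)

ExpansionOfLongCycle : Pred Graph 0ℓ
ExpansionOfLongCycle G =
  ∃[ k ] Σ[ 6≤k ∈ 6 ≤ k ] IsExpansionOf (cycle k (ℕ.≤-trans (ℕ.m≤m+n 3 3) 6≤k)) G

ConnectedCoTriangleFree : Pred Graph _
ConnectedCoTriangleFree G =
  Connected G × (∃[ H ] (TriangleFree H × G ≅ complement H))

{-# OPTIONS --safe #-}

-- Write u ∼ v for "equal or adjacent".  Claws, bulls and independent triples
-- are characterised by ∼ alone, so they pass freely between a graph and the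
-- graph it expands.  A connected (claw, bull)-free graph with an independent
-- triple contains an induced P₃ plus an isolated vertex, hence an induced P₅.
-- Take an induced path p₀ … pₖ with k ≥ 4 to which no pendant vertex can be
-- attached at either end.  Every vertex v is then ∼-related to exactly the
-- path vertices near some pᵢ, or to exactly p₀ and pₖ; in the first case it
-- goes to bag i, in the second to an extra bag k + 1 closing a cycle.
-- Two vertices are ∼-related precisely when their bags are equal or adjacent.

module Submission where

open import Defs
open import Data.Bool.Base using (if_then_else_)
open import Data.Empty as Empty using (⊥-elim)
open import Data.Fin.Base using (Fin; zero; suc; toℕ; fromℕ<; inject₁)
open import Data.Fin.Patterns using (0F; 1F; 2F; 3F; 4F)
import Data.Fin.Properties as Fin
open import Data.List.Base using ([])
open import Data.List.Relation.Unary.All using ([])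
open import Data.Nat.Base using (ℕ; zero; suc; _+_; _∸_; _≤_; _<_; z≤n; s≤s)
open import Data.Nat.Induction using (<-rec)
open import Data.Nat.Properties
open import Data.Product.Base using (∃-syntax; _×_; _,_; curry; proj₁; proj₂)
open import Data.Sum.Base using (_⊎_; inj₁; inj₂; [_,_]; map₂)
open import Function.Base using (_∘_; id)
open import Function.Bundles using (_⇔_; mk⇔; Equivalence; Inverse; Injection)
open import Function.Construct.Identity using (↔-id)
open import Function.Properties.Inverse using (Inverse⇒Injection)
open import Level using (0ℓ)
open import Relation.Binary.Construct.Closure.ReflexiveTransitive using (Star; ε; _◅_)
open import Relation.Binary.Core using (Rel)
open import Relation.Binary.Definitions using (tri<; tri≈; tri>)
open import Relation.Binary.PropositionalEquality
  using (_≡_; _≢_; refl; sym; trans; cong; subst; subst₂)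
open import Relation.Nullary.Decidable
  using (Dec; yes; no; does; True; False; toWitness; toWitnessFalse; decidable-stable;
         map′; ¬?; _×-dec_; _⊎-dec_; _→-dec_; from-yes)
open import Relation.Nullary.Negation using (¬_; contradiction)
open import Relation.Unary using (Pred; Decidable; _∪_; _⊥_)

-- The bounds four and six have one source. A vertex joined to all of an induced path on four
-- vertices creates neither a claw nor a bull; a fifth path vertex supplies the missing leaf or
-- horn, so k ≥ 4 is what makes the classification of attached vertices rigid. The extra bag then
-- closes a cycle with k + 2 ≥ 6 bags. Below these bounds a path or cycle has no independent triple,
-- so its expansions already are complements of triangle-free graphs; this is also why the classes
-- are disjoint. Each relation between attached vertices is proved by contradiction: its failure
-- exhibits a claw or a bull that uses path vertices close by. These witnesses must lie between p₀
-- and pₖ, and this forces most case splits: near one end of the path the configuration has to be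
-- replaced by its mirror image or by another one.

infix 4 _⊢_∼_ _⊢_≁_

_⊢_∼_ : (G : Graph) → Vertex G → Vertex G → Set
G ⊢ u ∼ v = u ≡ v ⊎ Adj G u v

_⊢_≁_ : (G : Graph) → Vertex G → Vertex G → Set
G ⊢ u ≁ v = ¬ (G ⊢ u ∼ v)

∼-dec : (G : Graph) (u v : Vertex G) → Dec (G ⊢ u ∼ v)
∼-dec G u v = (u Fin.≟ v) ⊎-dec Graph.adj? G u v

∼-sym : ∀ G {u v} → G ⊢ u ∼ v → G ⊢ v ∼ u
∼-sym G (inj₁ u≡v) = inj₁ (sym u≡v)
∼-sym G (inj₂ u~v) = inj₂ (Graph.adj-sym G u~v)

∼-stable : ∀ G {u v} → ¬ (G ⊢ u ≁ v) → G ⊢ u ∼ v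
∼-stable G {u} {v} = decidable-stable (∼-dec G u v)

∼⇒Adj : ∀ G {u v} → u ≢ v → G ⊢ u ∼ v → Adj G u v
∼⇒Adj G u≢v (inj₁ u≡v) = contradiction u≡v u≢v
∼⇒Adj G u≢v (inj₂ u~v) = u~v

infix 4 _⇉_

-- Such maps are not injective in general: they are exactly the maps that
-- become induced embeddings after true twins of F are identified.
record _⇉_ (F G : Graph) : Set where
  constructor mk⇉
  field
    fun      : Vertex F → Vertex G
    preserve : ∀ {i j} → F ⊢ i ∼ j → G ⊢ fun i ∼ fun j
    reflect  : ∀ {i j} → G ⊢ fun i ∼ fun j → F ⊢ i ∼ j

  near : ∀ i j → {True (∼-dec F i j)} → G ⊢ fun i ∼ fun j
  near i j {i∼j} = preserve (toWitness i∼j)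

  far : ∀ i j → {False (∼-dec F i j)} → G ⊢ fun i ≁ fun j
  far i j {i≁j} = toWitnessFalse i≁j ∘ reflect

_⇉∘_ : ∀ {F G H} → G ⇉ H → F ⇉ G → F ⇉ H
g ⇉∘ f = mk⇉ (fun g ∘ fun f) (preserve g ∘ preserve f) (reflect f ∘ reflect g)
  where open _⇉_

HasInduced⇒⇉ : ∀ {F G} → HasInduced F G → F ⇉ G
HasInduced⇒⇉ (f , f-inj , f-adj) = mk⇉ f
  [ (λ { refl → inj₁ refl }) , inj₂ ∘ Equivalence.to (f-adj _ _) ]
  [ inj₁ ∘ f-inj , inj₂ ∘ Equivalence.from (f-adj _ _) ]

-- The condition that makes a `⇉` map out of `F` injective: vertices with equal images would have
-- equal closed neighbourhoods.
TwinFree : Graph → Set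
TwinFree F = ∀ i j → i ≡ j ⊎ ∃[ l ] (F ⊢ i ∼ l × F ⊢ j ≁ l ⊎ F ⊢ j ∼ l × F ⊢ i ≁ l)

twinFree? : ∀ F → Dec (TwinFree F)
twinFree? F = Fin.all? λ i → Fin.all? λ j → (i Fin.≟ j) ⊎-dec
  Fin.any? λ l → (∼-dec F i l ×-dec ¬? (∼-dec F j l)) ⊎-dec (∼-dec F j l ×-dec ¬? (∼-dec F i l))

⇉⇒HasInduced : ∀ {F G} → TwinFree F → F ⇉ G → HasInduced F G
⇉⇒HasInduced {F} {G} twinFree f = fun , injective , λ i j → mk⇔ (to i j) (from i j)
  where
  open _⇉_ f

  injective : ∀ {i j} → fun i ≡ fun j → i ≡ j
  injective {i} {j} fi≡fj with twinFree i j
  ... | inj₁ i≡j = i≡j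
  ... | inj₂ (l , inj₁ (i∼l , j≁l)) =
    contradiction (reflect (subst (λ x → G ⊢ x ∼ fun l) fi≡fj (preserve i∼l))) j≁l
  ... | inj₂ (l , inj₂ (j∼l , i≁l)) =
    contradiction (reflect (subst (λ x → G ⊢ x ∼ fun l) (sym fi≡fj) (preserve j∼l))) i≁l

  to : ∀ i j → Adj F i j → Adj G (fun i) (fun j)
  to i j i~j = ∼⇒Adj G (λ fi≡fj → Graph.adj-irrefl F (injective fi≡fj) i~j) (preserve (inj₂ i~j))

  from : ∀ i j → Adj G (fun i) (fun j) → Adj F i j
  from i j fi~fj = ∼⇒Adj F (λ { refl → Graph.adj-irrefl G refl fi~fj }) (reflect (inj₂ fi~fj))

-- At concrete vertices the test computes, so the type reduces to a bare `∼` or `≁` fact and a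
-- hypothesis can serve directly as its proof.
Agree : (F G : Graph) → (Vertex F → Vertex G) → Vertex F → Vertex F → Set
Agree F G f i j = if does (∼-dec F i j) then G ⊢ f i ∼ f j else G ⊢ f i ≁ f j

then-branch : {P A B : Set} (P? : Dec P) → if does P? then A else B → P → A
then-branch (yes _) a _ = a
then-branch (no ¬p) _ p = contradiction p ¬p

else-branch : {P A : Set} (P? : Dec P) → if does P? then A else (¬ A) → A → P
else-branch (yes p) _  _ = p
else-branch (no _)  ¬a a = contradiction a ¬a

upper⇒⇉ : ∀ {F G} (f : Vertex F → Vertex G) →
          (∀ i j → toℕ i < toℕ j → Agree F G f i j) → F ⇉ G
upper⇒⇉ {F} {G} f upper = mk⇉ f (λ {i} {j} → preserve i j) (λ {i} {j} → reflect i j)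
  where
  preserve< : ∀ i j → toℕ i < toℕ j → F ⊢ i ∼ j → G ⊢ f i ∼ f j
  preserve< i j i<j = then-branch (∼-dec F i j) (upper i j i<j)

  reflect< : ∀ i j → toℕ i < toℕ j → G ⊢ f i ∼ f j → F ⊢ i ∼ j
  reflect< i j i<j = else-branch (∼-dec F i j) (upper i j i<j)

  preserve : ∀ i j → F ⊢ i ∼ j → G ⊢ f i ∼ f j
  preserve i j i∼j with Fin.<-cmp i j
  ... | tri< i<j _ _  = preserve< i j i<j i∼j
  ... | tri≈ _ refl _ = inj₁ refl
  ... | tri> _ _ j<i  = ∼-sym G (preserve< j i j<i (∼-sym F i∼j))

  reflect : ∀ i j → G ⊢ f i ∼ f j → F ⊢ i ∼ j
  reflect i j fi∼fj with Fin.<-cmp i j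
  ... | tri< i<j _ _  = reflect< i j i<j fi∼fj
  ... | tri≈ _ refl _ = inj₁ refl
  ... | tri> _ _ j<i  = ∼-sym F (reflect< j i j<i (∼-sym G fi∼fj))

3K₁ : Graph
3K₁ = fromEdges 3 [] []

module _ {G : Graph} where

  private
    infix 4 _∼_ _≁_
    _∼_ = G ⊢_∼_
    _≁_ = G ⊢_≁_

  claw⇉ : ∀ {a b c d} → a ∼ b → a ∼ c → a ∼ d → b ≁ c → b ≁ d → c ≁ d → claw ⇉ G
  claw⇉ {a} {b} {c} {d} ab ac ad bc bd cd = upper⇒⇉ f upper
    where
    f : Vertex claw → Vertex G
    f 0F = a
    f 1F = b
    f 2F = c
    f 3F = d

    upper : ∀ i j → toℕ i < toℕ j → Agree claw G f i j
    upper 0F 1F _ = ab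
    upper 0F 2F _ = ac
    upper 0F 3F _ = ad
    upper 1F 1F (s≤s ())
    upper 1F 2F _ = bc
    upper 1F 3F _ = bd
    upper 2F 1F (s≤s ())
    upper 2F 2F (s≤s (s≤s ()))
    upper 2F 3F _ = cd
    upper 3F 1F (s≤s ())
    upper 3F 2F (s≤s (s≤s ()))
    upper 3F 3F (s≤s (s≤s (s≤s ())))

  -- The triangle is a, b, c, with horn d at a and horn e at b. Distinctness of the images is
  -- recovered afterwards from `TwinFree`.
  bull⇉ : ∀ {a b c d e} → a ∼ b → b ∼ c → a ∼ c → a ∼ d → b ∼ e →
          d ≁ b → d ≁ c → e ≁ a → e ≁ c → d ≁ e → bull ⇉ G
  bull⇉ {a} {b} {c} {d} {e} ab bc ac ad be db dc ea ec de = upper⇒⇉ f upper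
    where
    f : Vertex bull → Vertex G
    f 0F = a
    f 1F = b
    f 2F = c
    f 3F = d
    f 4F = e

    upper : ∀ i j → toℕ i < toℕ j → Agree bull G f i j
    upper 0F 1F _ = ab
    upper 0F 2F _ = ac
    upper 0F 3F _ = ad
    upper 0F 4F _ = ea ∘ ∼-sym G
    upper 1F 1F (s≤s ())
    upper 1F 2F _ = bc
    upper 1F 3F _ = db ∘ ∼-sym G
    upper 1F 4F _ = be
    upper 2F 1F (s≤s ())
    upper 2F 2F (s≤s (s≤s ()))
    upper 2F 3F _ = dc ∘ ∼-sym G
    upper 2F 4F _ = ec ∘ ∼-sym G
    upper 3F 1F (s≤s ())
    upper 3F 2F (s≤s (s≤s ()))
    upper 3F 3F (s≤s (s≤s (s≤s ())))
    upper 3F 4F _ = de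
    upper 4F 1F (s≤s ())
    upper 4F 2F (s≤s (s≤s ()))
    upper 4F 3F (s≤s (s≤s (s≤s ())))
    upper 4F 4F (s≤s (s≤s (s≤s (s≤s ()))))

  3K₁⇉ : ∀ {a b c} → a ≁ b → a ≁ c → b ≁ c → 3K₁ ⇉ G
  3K₁⇉ {a} {b} {c} ab ac bc = upper⇒⇉ f upper
    where
    f : Vertex 3K₁ → Vertex G
    f 0F = a
    f 1F = b
    f 2F = c

    upper : ∀ i j → toℕ i < toℕ j → Agree 3K₁ G f i j
    upper 0F 1F _ = ab
    upper 0F 2F _ = ac
    upper 1F 1F (s≤s ())
    upper 1F 2F _ = bc
    upper 2F 1F (s≤s ())
    upper 2F 2F (s≤s (s≤s ()))

⇉⇒claw : ∀ {G} → claw ⇉ G → HasInduced claw G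
⇉⇒claw = ⇉⇒HasInduced (from-yes (twinFree? claw))

⇉⇒bull : ∀ {G} → bull ⇉ G → HasInduced bull G
⇉⇒bull = ⇉⇒HasInduced (from-yes (twinFree? bull))

-- Expansions as surjective maps

expansion⇒⇉ : ∀ {F G} → IsExpansionOf F G → G ⇉ F
expansion⇒⇉ {F} {G} ex = mk⇉ bag (preserve _ _) (reflect _ _)
  where
  open IsExpansionOf ex

  preserve : ∀ u v → G ⊢ u ∼ v → F ⊢ bag u ∼ bag v
  preserve u v (inj₁ refl) = inj₁ refl
  preserve u v (inj₂ u~v) with bag u Fin.≟ bag v
  ... | yes bu≡bv = inj₁ bu≡bv
  ... | no  bu≢bv = inj₂ (no-other bu≢bv u~v)

  reflect : ∀ u v → F ⊢ bag u ∼ bag v → G ⊢ u ∼ v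
  reflect u v (inj₂ bu~bv) = inj₂ (joined bu~bv)
  reflect u v (inj₁ bu≡bv) with u Fin.≟ v
  ... | yes u≡v = inj₁ u≡v
  ... | no  u≢v = inj₂ (clique bu≡bv u≢v)

-- Together with `expansion⇒⇉` this identifies expansions of `F` with surjective `⇉` maps onto `F`:
-- cliques and joins are two instances of `reflect`, and the absence of other edges is `preserve`.
⇉⇒expansion : ∀ {F G} (f : G ⇉ F) → (∀ i → ∃[ v ] _⇉_.fun f v ≡ i) → IsExpansionOf F G
⇉⇒expansion {F} {G} f surjective = record
  { bag      = fun
  ; nonempty = surjective
  ; clique   = λ bu≡bv u≢v → ∼⇒Adj G u≢v (reflect (inj₁ bu≡bv))
  ; joined   = λ bu~bv → ∼⇒Adj G (λ { refl → Graph.adj-irrefl F refl bu~bv }) (reflect (inj₂ bu~bv))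
  ; no-other = λ bu≢bv u~v → ∼⇒Adj F bu≢bv (preserve (inj₂ u~v))
  }
  where open _⇉_ f

section⇉ : ∀ {F G} → IsExpansionOf F G → F ⇉ G
section⇉ {F} {G} ex = mk⇉ rep
  (λ i∼j → reflect (subst₂ (F ⊢_∼_) (sym (bag-rep _)) (sym (bag-rep _)) i∼j))
  (λ ri∼rj → subst₂ (F ⊢_∼_) (bag-rep _) (bag-rep _) (preserve ri∼rj))
  where
  open IsExpansionOf ex
  open _⇉_ (expansion⇒⇉ ex) using (preserve; reflect)

  rep : Vertex F → Vertex G
  rep i = proj₁ (nonempty i)

  bag-rep : ∀ i → bag (rep i) ≡ i
  bag-rep i = proj₂ (nonempty i)

-- Independent triples and complements of triangle-free graphs

coTriangleFree⇒¬3K₁ : ∀ {G} → ConnectedCoTriangleFree G → ¬ (3K₁ ⇉ G)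
coTriangleFree⇒¬3K₁ {G} (_ , H , H-triangleFree , φ , φ-adj) f =
  H-triangleFree (h , h-injective , λ i j → mk⇔ (to i j) (from i j))
  where
  open _⇉_ f
  h : Fin 3 → Vertex H
  h i = Inverse.to φ (fun i)

  h-injective : ∀ {i j} → h i ≡ h j → i ≡ j
  h-injective {i} {j} hi≡hj with reflect {i} {j} (inj₁ (Injection.injective (Inverse⇒Injection φ) hi≡hj))
  ... | inj₁ i≡j = i≡j
  ... | inj₂ (inj₁ ())
  ... | inj₂ (inj₂ ())

  from : ∀ i j → Adj H (h i) (h j) → Adj triangle i j
  from i j hi~hj = complete i j (λ { refl → Graph.adj-irrefl H refl hi~hj })
    where
    complete : ∀ i j → i ≢ j → Adj triangle i j
    complete = from-yes (Fin.all? λ i → Fin.all? λ j → ¬? (i Fin.≟ j) →-dec Graph.adj? triangle i j)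

  to : ∀ i j → Adj triangle i j → Adj H (h i) (h j)
  -- Non-adjacency in `H` would make the images adjacent in its complement, hence in `G`, although
  -- `3K₁` has no edge.
  to i j i~j = decidable-stable (Graph.adj? H (h i) (h j)) λ hi≁hj →
    let fi~fj = Equivalence.from (φ-adj _ _) ((λ hi≡hj → i≢j (h-injective hi≡hj)) , hi≁hj)
    in [ i≢j , (λ { (inj₁ ()) ; (inj₂ ()) }) ] (reflect {i} {j} (inj₂ fi~fj))
    where
    i≢j : i ≢ j
    i≢j i≡j = Graph.adj-irrefl triangle i≡j i~j

¬3K₁⇒coTriangleFree : ∀ {G} → Connected G → ¬ (3K₁ ⇉ G) → ConnectedCoTriangleFree G
¬3K₁⇒coTriangleFree {G} connected ¬3K₁ =
  connected , complement G , triangleFree , ↔-id _ , λ u v → mk⇔ (to u v) (from u v)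
  where
  triangleFree : TriangleFree (complement G)
  triangleFree (f , _ , f-adj) = ¬3K₁ (3K₁⇉ (far 0F 1F) (far 0F 2F) (far 1F 2F))
    where
    far : ∀ i j → {True (Graph.adj? triangle i j)} → G ⊢ f i ≁ f j
    far i j {i~j} with Equivalence.to (f-adj i j) (toWitness i~j)
    ... | fi≢fj , ¬fi~fj = [ fi≢fj , ¬fi~fj ]

  to : ∀ u v → Adj G u v → Adj (complement (complement G)) u v
  to u v u~v = (λ u≡v → Graph.adj-irrefl G u≡v u~v) , λ (_ , u≁v) → u≁v u~v

  from : ∀ u v → Adj (complement (complement G)) u v → Adj G u v
  from u v (u≢v , ¬¬u~v) = decidable-stable (Graph.adj? G u v) λ u≁v → ¬¬u~v (u≢v , u≁v)

-- Vertices attached to an induced path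

data Near : ℕ → ℕ → Set where
  same : ∀ {i} → Near i i
  up   : ∀ {i} → Near i (suc i)
  down : ∀ {i} → Near (suc i) i

Far : ℕ → ℕ → Set
Far i j = suc i < j ⊎ suc j < i

near-or-far : ∀ i j → Near i j ⊎ Far i j
near-or-far zero          zero          = inj₁ same
near-or-far zero          (suc zero)    = inj₁ up
near-or-far zero          (suc (suc j)) = inj₂ (inj₁ (s≤s (s≤s z≤n)))
near-or-far (suc zero)    zero          = inj₁ down
near-or-far (suc (suc i)) zero          = inj₂ (inj₂ (s≤s (s≤s z≤n)))
near-or-far (suc i)       (suc j) with near-or-far i j
... | inj₁ same       = inj₁ same
... | inj₁ up         = inj₁ up
... | inj₁ down       = inj₁ down
... | inj₂ (inj₁ i<j) = inj₂ (inj₁ (s≤s i<j))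
... | inj₂ (inj₂ j<i) = inj₂ (inj₂ (s≤s j<i))

-- `p` is total on ℕ to keep index arithmetic out of `Fin`; only its values up to k are constrained.
-- Distinctness of the vertices is derived for k ≥ 4 in `path-injective`.
record InducedPath (G : Graph) (p : ℕ → Vertex G) (k : ℕ) : Set where
  field
    step : ∀ {i} → suc i ≤ k → G ⊢ p i ∼ p (suc i)
    skip : ∀ {i j} → suc i < j → j ≤ k → G ⊢ p i ≁ p j

  near : ∀ {i j} → i ≤ k → j ≤ k → Near i j → G ⊢ p i ∼ p j
  near i≤k j≤k same = inj₁ refl
  near i≤k j≤k up   = step j≤k
  near i≤k j≤k down = ∼-sym G (step i≤k)

  far : ∀ {i j} → i ≤ k → j ≤ k → Far i j → G ⊢ p i ≁ p j
  far i≤k j≤k (inj₁ i<j) = skip i<j j≤k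
  far i≤k j≤k (inj₂ j<i) = skip j<i i≤k ∘ ∼-sym G

Pendant : (G : Graph) → (ℕ → Vertex G) → ℕ → Vertex G → Set
Pendant G p k v = G ⊢ v ∼ p 0 × (∀ {i} → i < k → G ⊢ v ≁ p (suc i))

pendant? : ∀ G p k v → Dec (Pendant G p k v)
pendant? G p k v = ∼-dec G v (p 0) ×-dec allUpTo? (λ i → ¬? (∼-dec G v (p (suc i)))) k

prepend : ∀ {A : Set} → A → (ℕ → A) → ℕ → A
prepend v p zero    = v
prepend v p (suc i) = p i

prepend-inducedPath : ∀ {G p k v} → InducedPath G p k → Pendant G p k v →
                      InducedPath G (prepend v p) (suc k)
prepend-inducedPath {G} {p} {k} {v} P (v∼p₀ , v≁p) = record { step = step′ ; skip = skip′ }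
  where
  open InducedPath P
  step′ : ∀ {i} → suc i ≤ suc k → G ⊢ prepend v p i ∼ p i
  step′ {zero}  _         = v∼p₀
  step′ {suc i} (s≤s i<k) = step i<k

  skip′ : ∀ {i j} → suc i < j → j ≤ suc k → G ⊢ prepend v p i ≁ prepend v p j
  skip′ {zero}  {suc (suc j)} _           (s≤s j<k) = v≁p j<k
  skip′ {zero}  {suc zero}    (s≤s ())    _
  skip′ {suc i} {suc j}       (s≤s i<j)   (s≤s j≤k) = skip i<j j≤k

reverse : ∀ {A : Set} → ℕ → (ℕ → A) → ℕ → A
reverse k p i = p (k ∸ i)

reverse-inducedPath : ∀ {G p k} → InducedPath G p k → InducedPath G (reverse k p) k
reverse-inducedPath {G} {p} {k} P = record
  { step = λ {i} i<k → ∼-sym G (subst (λ j → G ⊢ p (k ∸ suc i) ∼ p j) (suc-∸ i<k)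
                                 (step (subst (_≤ k) (sym (suc-∸ i<k)) (m∸n≤m k i))))
  ; skip = λ {i} {j} i<j j≤k → skip (skips i<j j≤k) (m∸n≤m k i) ∘ ∼-sym G
  }
  where
  open InducedPath P

  suc-∸ : ∀ {i} → i < k → suc (k ∸ suc i) ≡ k ∸ i
  suc-∸ i<k = sym (+-∸-assoc 1 i<k)

  skips : ∀ {i j} → suc i < j → j ≤ k → suc (k ∸ j) < k ∸ i
  -- Both sides are differences from `suc k`: the claim is `suc k ∸ j < suc k ∸ suc i`.
  skips {i} {j} i<j j≤k = subst (_< k ∸ i) (+-∸-assoc 1 j≤k) (∸-monoʳ-< {suc k} i<j (m≤n⇒m≤1+n j≤k))

module Along {G : Graph} (noClaw : ¬ (claw ⇉ G)) (noBull : ¬ (bull ⇉ G))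
             {n : ℕ} {p : ℕ → Vertex G} (P : InducedPath G p (4 + n)) where

  open InducedPath P

  private
    infix 4 _∼_ _≁_
    _∼_ = G ⊢_∼_
    _≁_ = G ⊢_≁_

    k : ℕ
    k = 4 + n

    V : Set
    V = Vertex G

    ~ : ∀ {u v} → u ∼ v → v ∼ u
    ~ = ∼-sym G

    ≁-sym : ∀ {u v} → u ≁ v → v ≁ u
    ≁-sym u≁v = u≁v ∘ ~

    gap : ∀ i d → 2 + d + i ≤ k → p i ≁ p (2 + d + i)
    gap i d = skip (s≤s (s≤s (m≤n+m i d)))

    gap′ : ∀ i d → 2 + d + i ≤ k → p (2 + d + i) ≁ p i
    gap′ i d i≤k = ≁-sym (gap i d i≤k)

    below : ∀ d {i} → d + i ≤ k → i ≤ k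
    below d = m+n≤o⇒n≤o d

    first : ∀ d {m} → d ≤ d + m
    first d = m≤m+n d _

  -- Since k ≥ 4, some path vertex q continues the run on one side. If v sees q, then q and two
  -- alternate vertices of the run are the leaves of a claw at v. Otherwise v and the two run
  -- vertices nearest to q form a triangle whose horns are q and the far end of the run.
  fourRun : ∀ {v} i → 3 + i ≤ k → v ∼ p i → v ∼ p (1 + i) → v ∼ p (2 + i) → v ∼ p (3 + i) → Empty.⊥
  fourRun {v} i i≤k c₀ c₁ c₂ c₃ with m≤n⇒m<n∨m≡n i≤k
  ... | inj₁ 4+i≤k with ∼-dec G v (p (4 + i))
  ...   | yes c₄ = noClaw (claw⇉ c₀ c₂ c₄ (gap i 0 (below 1 i≤k)) (gap i 2 4+i≤k) (gap (2 + i) 0 4+i≤k))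
  ...   | no ¬c₄ = noBull (bull⇉ {b = v} {d = p (4 + i)} {e = p i} (~ c₃) c₂ (~ (step i≤k)) (step 4+i≤k) c₀
                            (≁-sym ¬c₄) (gap′ (2 + i) 0 4+i≤k) (gap i 1 i≤k) (gap i 0 (below 1 i≤k))
                            (gap′ i 2 4+i≤k))
  fourRun {v} i i≤k c₀ c₁ c₂ c₃ | inj₂ refl with ∼-dec G v (p n)
  ...   | yes c = noClaw (claw⇉ c c₁ c₃ (gap n 0 (m≤n+m _ 2)) (gap n 2 ≤-refl) (gap (2 + n) 0 ≤-refl))
  ...   | no ¬c = noBull (bull⇉ {b = v} {d = p n} {e = p (4 + n)} (~ c₀) c₁ (step (m≤n+m _ 2)) (~ (step (m≤n+m _ 3))) c₃
                            (≁-sym ¬c) (gap n 0 (m≤n+m _ 2)) (gap′ (1 + n) 1 ≤-refl) (gap′ (2 + n) 0 ≤-refl)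
                            (gap n 2 ≤-refl))

  record Inner (v : V) (i : ℕ) : Set where
    constructor mkInner
    field
      i≤k : i ≤ k
      on  : ∀ {j} → j ≤ k → Near i j → v ∼ p j
      off : ∀ {j} → j ≤ k → Far i j → v ≁ p j

  record Outer (v : V) : Set where
    constructor mkOuter
    field
      start   : v ∼ p 0
      end     : v ∼ p k
      between : ∀ {j} → suc j < k → v ≁ p (suc j)

  data Kind (v : V) : Set where
    inner : ∀ {i} → Inner v i → Kind v
    outer : Outer v → Kind v

  -- A further neighbour of v on the path is the third leaf of a claw at v beside p i and p (2 + i),
  -- unless it continues the run, where `fourRun` applies.
  triple⇒inner : ∀ {v i} → 2 + i ≤ k → v ∼ p i → v ∼ p (1 + i) → v ∼ p (2 + i) → Inner v (1 + i)
  triple⇒inner {v} {i} i≤k c₀ c₁ c₂ = mkInner (below 1 i≤k) on off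
    where
    on : ∀ {j} → j ≤ k → Near (1 + i) j → v ∼ p j
    on _ same = c₁
    on _ up   = c₂
    on _ down = c₀

    off : ∀ {j} → j ≤ k → Far (1 + i) j → v ≁ p j
    off j≤k (inj₁ i<j) c with m≤n⇒m<n∨m≡n i<j
    ... | inj₁ 4+i≤j = noClaw (claw⇉ c₀ c₂ c
      (gap i 0 i≤k) (skip (≤-trans (m≤n+m _ 2) 4+i≤j) j≤k) (skip 4+i≤j j≤k))
    ... | inj₂ refl  = fourRun i j≤k c₀ c₁ c₂ c
    off j≤k (inj₂ (s≤s j<i)) c with m≤n⇒m<n∨m≡n j<i
    ... | inj₁ 1+j<i = noClaw (claw⇉ c c₀ c₂
      (skip 1+j<i (below 2 i≤k)) (skip (≤-trans 1+j<i (m≤n+m _ 2)) i≤k) (gap i 0 i≤k))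
    ... | inj₂ refl  = fourRun _ i≤k c c₀ c₁ c₂

  module _ {v : V} (noTriple : ∀ {i} → 2 + i ≤ k → v ∼ p i → v ∼ p (1 + i) → v ≁ p (2 + i)) where

    -- The pair and v form a triangle; the path vertices just before and after the pair are its
    -- horns, which v misses for want of a triple.
    noPair : ∀ {i} → 3 + i ≤ k → v ∼ p (1 + i) → v ≁ p (2 + i)
    noPair {i} i≤k c₁ c₂ = noBull (bull⇉ {b = p (2 + i)} {d = p i} {e = p (3 + i)}
      (step (below 1 i≤k)) (~ c₂) (~ c₁) (~ (step (below 2 i≤k))) (step i≤k)
      (gap i 0 (below 1 i≤k)) (λ c → noTriple (below 1 i≤k) (~ c) c₁ c₂)
      (gap′ (1 + i) 0 i≤k) (λ c → noTriple i≤k c₁ c₂ (~ c)) (gap i 1 i≤k))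

    -- Otherwise v and both path neighbours of p (1 + i) are the leaves of a claw.
    neighbour : ∀ {i} → 2 + i ≤ k → v ∼ p (1 + i) → v ≁ p i → v ∼ p (2 + i)
    neighbour {i} i≤k c ¬c₀ = ∼-stable G λ ¬c₂ →
      noClaw (claw⇉ (~ c) (~ (step (below 1 i≤k))) (step i≤k) ¬c₀ ¬c₂ (gap i 0 i≤k))

    -- A neighbour p j with j ≥ 4 would be a horn at v of the triangle p 1, v, p 0, whose other horn
    -- is p 2. A neighbour p 3 would force p 4 by `neighbour`, and p 4 exists since k ≥ 4.
    firstPair⇒inner : v ∼ p 0 → v ∼ p 1 → Inner v 0
    firstPair⇒inner c₀ c₁ = mkInner z≤n on off
      where
      ¬c₂ : v ≁ p 2
      ¬c₂ = noTriple (first 2) c₀ c₁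

      beyond : ∀ {j} → 4 ≤ j → j ≤ k → v ≁ p j
      beyond 4≤j j≤k c = noBull (bull⇉ {b = v} {d = p 2} (~ c₁) c₀ (~ (step (first 1))) (step (first 2)) c
        (≁-sym ¬c₂) (gap′ 0 0 (first 2)) (≁-sym (skip (≤-trans (m≤n+m 3 1) 4≤j) j≤k))
        (≁-sym (skip (≤-trans (m≤n+m 2 2) 4≤j) j≤k)) (skip 4≤j j≤k))

      on : ∀ {j} → j ≤ k → Near 0 j → v ∼ p j
      on _ same = c₀
      on _ up   = c₁

      off : ∀ {j} → j ≤ k → Far 0 j → v ≁ p j
      off {1} _ (inj₁ (s≤s ()))
      off {2} _ _ = ¬c₂
      off {3} _ _ c = beyond ≤-refl (first 4) (neighbour (first 4) c ¬c₂)
      off {suc (suc (suc (suc j)))} j≤k _ = beyond (first 4) j≤k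

    lastPair⇒inner : v ∼ p (3 + n) → v ∼ p (4 + n) → Inner v (4 + n)
    lastPair⇒inner c₃ c₄ = mkInner ≤-refl on off
      where
      ¬c₂ : v ≁ p (2 + n)
      ¬c₂ c₂ = noTriple ≤-refl c₂ c₃ c₄

      beyond : ∀ {j} → j ≤ n → v ≁ p j
      beyond j≤n c = noBull (bull⇉ {b = v} {d = p (2 + n)} (~ c₃) c₄ (step ≤-refl) (~ (step (m≤n+m _ 1))) c
        (≁-sym ¬c₂) (gap (2 + n) 0 ≤-refl) (skip (s≤s (s≤s (m≤n⇒m≤1+n j≤n))) (m≤n+m _ 1))
        (skip (s≤s (s≤s (m≤n⇒m≤1+n (m≤n⇒m≤1+n j≤n)))) ≤-refl) (≁-sym (skip (s≤s (s≤s j≤n)) (m≤n+m _ 2))))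

      on : ∀ {j} → j ≤ k → Near (4 + n) j → v ∼ p j
      on _   same = c₄
      on j≤k up   = contradiction j≤k 1+n≰n
      on _   down = c₃

      off : ∀ {j} → j ≤ k → Far (4 + n) j → v ≁ p j
      off j≤k (inj₁ k<j) = contradiction (≤-trans (m≤n+m _ 1) (≤-trans k<j j≤k)) 1+n≰n
      off _ (inj₂ (s≤s (s≤s j≤2+n))) with m≤n⇒m<n∨m≡n j≤2+n
      ... | inj₂ refl = ¬c₂
      ... | inj₁ (s≤s j≤1+n) with m≤n⇒m<n∨m≡n j≤1+n
      ...   | inj₁ (s≤s j≤n) = beyond j≤n
      -- `neighbour` moves only to the right, so the step from p (1 + n) back to p n is made by
      -- contraposition.
      ...   | inj₂ refl      = λ c → beyond ≤-refl (∼-stable G λ ¬c₀ → ¬c₂ (neighbour (m≤n+m _ 2) c ¬c₀))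

    -- By `neighbour` an interior contact comes with a consecutive one; such a pair lies at the
    -- start, at the end, or in the interior, where `noPair` excludes it.
    noInterior : ¬ (v ∼ p 0 × v ∼ p 1) → ¬ (v ∼ p (3 + n) × v ∼ p (4 + n)) →
                 ∀ {j} → suc j < k → v ≁ p (suc j)
    noInterior ¬first ¬last {j} j<k c with ∼-dec G v (p j)
    noInterior ¬first ¬last {zero}  j<k c | yes c₀ = ¬first (c₀ , c)
    noInterior ¬first ¬last {suc j} j<k c | yes c₀ = noPair j<k c₀ c
    noInterior ¬first ¬last {j}     j<k c | no ¬c₀ with m≤n⇒m<n∨m≡n j<k
    ... | inj₁ 2+j<k = noPair 2+j<k c (neighbour j<k c ¬c₀)
    ... | inj₂ refl  = ¬last (c , neighbour j<k c ¬c₀)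

  -- Adjacency among attached vertices

  inner∼inner : ∀ {u v i} → Inner u i → Inner v i → u ∼ v
  -- The claw is centred at a path vertex next to position i; its leaves are u, v and the path
  -- vertex one step further. It points right for i ≤ 1, where k ≥ 4 leaves room, and left from i =
  -- 2 on.
  inner∼inner {i = zero} U V = ∼-stable G λ u≁v → noClaw (claw⇉
    (~ (Inner.on U (first 1) up)) (~ (Inner.on V (first 1) up)) (step (first 2))
    u≁v (Inner.off U (first 2) farʳ) (Inner.off V (first 2) farʳ))
    where farʳ = inj₁ ≤-refl
  inner∼inner {i = suc zero} U V = ∼-stable G λ u≁v → noClaw (claw⇉
    (~ (Inner.on U (first 2) up)) (~ (Inner.on V (first 2) up)) (step (first 3))
    u≁v (Inner.off U (first 3) farʳ) (Inner.off V (first 3) farʳ))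
    where farʳ = inj₁ ≤-refl
  inner∼inner {i = suc (suc i)} U V = ∼-stable G λ u≁v → noClaw (claw⇉
    (~ (Inner.on U (below 1 i≤k) down)) (~ (Inner.on V (below 1 i≤k) down)) (~ (step (below 1 i≤k)))
    u≁v (Inner.off U (below 2 i≤k) farˡ) (Inner.off V (below 2 i≤k) farˡ))
    where
    farˡ = inj₂ ≤-refl
    i≤k = Inner.i≤k U

  -- Failing this, the triangle p (1 + i), p (2 + i), v with horns u and p (3 + i) is a bull. From i
  -- = 2 on the mirror image is used, as p (3 + i) may lie past the end.
  inner∼innerʳ : ∀ {u v i} → Inner u i → Inner v (suc i) → u ∼ v
  inner∼innerʳ {u} {v} {zero} U V = ∼-stable G λ u≁v → noBull (bull⇉ {c = v} {d = u} {e = p 3}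
    (step (first 2)) (~ (Inner.on V (first 2) up)) (~ (Inner.on V (first 1) same))
    (~ (Inner.on U (first 1) up)) (step (first 3))
    (Inner.off U (first 2) (inj₁ ≤-refl)) u≁v (gap′ 1 0 (first 3))
    (≁-sym (Inner.off V (first 3) (inj₁ ≤-refl))) (Inner.off U (first 3) (inj₁ (m≤n+m _ 1))))
  inner∼innerʳ {u} {v} {suc zero} U V = ∼-stable G λ u≁v → noBull (bull⇉ {c = v} {d = u} {e = p 4}
    (step (first 3)) (~ (Inner.on V (first 3) up)) (~ (Inner.on V (first 2) same))
    (~ (Inner.on U (first 2) up)) (step (first 4))
    (Inner.off U (first 3) (inj₁ ≤-refl)) u≁v (gap′ 2 0 (first 4))
    (≁-sym (Inner.off V (first 4) (inj₁ ≤-refl))) (Inner.off U (first 4) (inj₁ (m≤n+m _ 1))))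
  inner∼innerʳ {u} {v} {suc (suc i)} U V = ∼-stable G λ u≁v → noBull (bull⇉ {c = u} {d = v} {e = p i}
    (~ (step (below 1 i≤k))) (~ (Inner.on U (below 2 i≤k) down)) (~ (Inner.on U (below 1 i≤k) same))
    (~ (Inner.on V (below 1 i≤k) down)) (~ (step (below 2 i≤k)))
    (Inner.off V (below 2 i≤k) (inj₂ ≤-refl)) (≁-sym u≁v) (gap i 0 (below 1 i≤k))
    (≁-sym (Inner.off U (below 3 i≤k) (inj₂ ≤-refl))) (Inner.off V (below 3 i≤k) (inj₂ (m≤n+m _ 1))))
    where i≤k = Inner.i≤k V

  -- An edge uv gives a claw at u with leaves p (i - 1), p (i + 1), v once i ≥ 1 and j ≥ i + 3. The
  -- remaining cases, i = 0 or j = i + 2, give bulls, except for the claw at v when i = 0 and j = 3.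
  inner≁inner : ∀ {u v i j} → suc i < j → Inner u i → Inner v j → u ≁ v
  inner≁inner {i = zero} {suc zero} (s≤s ()) _ _ _
  inner≁inner {u} {v} {zero} {2} _ U V u∼v = noBull (bull⇉ {b = v} {d = p 4} {e = u}
    (~ (Inner.on V (first 3) up)) (Inner.on V (first 2) same) (~ (step (first 3))) (step (first 4)) (~ u∼v)
    (≁-sym (Inner.off V (first 4) (inj₁ ≤-refl))) (gap′ 2 0 (first 4))
    (Inner.off U (first 3) (inj₁ (m≤n+m _ 1))) (Inner.off U (first 2) (inj₁ ≤-refl))
    (≁-sym (Inner.off U (first 4) (inj₁ (m≤n+m _ 2)))))
  inner≁inner {u} {v} {zero} {3} _ U V u∼v = noClaw (claw⇉
    (~ u∼v) (Inner.on V (first 2) down) (Inner.on V (first 4) up)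
    (Inner.off U (first 2) (inj₁ ≤-refl)) (Inner.off U (first 4) (inj₁ (m≤n+m _ 2))) (gap 2 0 (first 4)))
  inner≁inner {u} {v} {zero} {suc (suc (suc (suc j)))} _ U V u∼v = noBull (bull⇉ {b = u} {d = p 2} {e = v}
    (~ (Inner.on U (first 1) up)) (Inner.on U z≤n same) (~ (step (first 1))) (step (first 2)) u∼v
    (≁-sym (Inner.off U (first 2) (inj₁ ≤-refl))) (gap′ 0 0 (first 2))
    (Inner.off V (first 1) (inj₂ (s≤s (s≤s (s≤s z≤n))))) (Inner.off V z≤n (inj₂ (s≤s (s≤s z≤n))))
    (≁-sym (Inner.off V (first 2) (inj₂ (s≤s (s≤s (s≤s (s≤s z≤n))))))))
  inner≁inner {u} {v} {suc i} {j} i<j U V u∼v with m≤n⇒m<n∨m≡n i<j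
  ... | inj₁ 3+i<j = noClaw (claw⇉
    (Inner.on U (below 2 i≤k) down) (Inner.on U i≤k up) u∼v
    (gap i 0 i≤k) (≁-sym (Inner.off V (below 2 i≤k) (inj₂ (≤-trans (m≤n+m _ 2) 3+i<j))))
    (≁-sym (Inner.off V i≤k (inj₂ 3+i<j))))
    where
    i≤k : 2 + i ≤ k
    i≤k = ≤-trans (≤-trans (m≤n+m _ 1) i<j) (Inner.i≤k V)
  -- For i = 1 there is no p (i - 2) to serve as a horn, so the triangle is u, v, p 2 with horns p 0
  -- and p 4.
  inner≁inner {u} {v} {suc zero} _ U V u∼v | inj₂ refl = noBull (bull⇉ {b = v} {d = p 0} {e = p 4}
    u∼v (Inner.on V (first 2) down) (Inner.on U (first 2) up) (Inner.on U z≤n down) (Inner.on V (first 4) up)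
    (≁-sym (Inner.off V z≤n (inj₂ (m≤n+m _ 1)))) (gap 0 0 (first 2))
    (≁-sym (Inner.off U (first 4) (inj₁ (m≤n+m _ 1)))) (gap′ 2 0 (first 4)) (gap 0 2 (first 4)))
  inner≁inner {u} {v} {suc (suc i)} _ U V u∼v | inj₂ refl = noBull (bull⇉ {b = u} {d = p i} {e = v}
    (~ (Inner.on U (below 3 i≤k) down)) (Inner.on U (below 2 i≤k) same) (step (below 2 i≤k))
    (~ (step (below 3 i≤k))) u∼v
    (≁-sym (Inner.off U (below 4 i≤k) (inj₂ ≤-refl))) (gap i 0 (below 2 i≤k))
    (Inner.off V (below 3 i≤k) (inj₂ (m≤n+m _ 1))) (Inner.off V (below 2 i≤k) (inj₂ ≤-refl))
    (≁-sym (Inner.off V (below 4 i≤k) (inj₂ (m≤n+m _ 2)))))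
    where i≤k = Inner.i≤k V

  outer∼outer : ∀ {u v} → Outer u → Outer v → u ∼ v
  outer∼outer U V = ∼-stable G λ u≁v → noClaw (claw⇉
    (~ (Outer.start U)) (~ (Outer.start V)) (step (first 1))
    u≁v (Outer.between U (first 2)) (Outer.between V (first 2)))

  outer∼first : ∀ {u v} → Outer u → Inner v 0 → u ∼ v
  outer∼first {u} {v} U V = ∼-stable G λ u≁v → noBull (bull⇉ {c = v} {d = u} {e = p 2}
    (step (first 1)) (~ (Inner.on V (first 1) up)) (~ (Inner.on V z≤n same)) (~ (Outer.start U)) (step (first 2))
    (Outer.between U (first 2)) u≁v (gap′ 0 0 (first 2)) (≁-sym (Inner.off V (first 2) (inj₁ ≤-refl)))
    (Outer.between U (first 3)))

  outer∼last : ∀ {u v} → Outer u → Inner v k → u ∼ v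
  outer∼last {u} {v} U V = ∼-stable G λ u≁v → noBull (bull⇉ {c = v} {d = u} {e = p (2 + n)}
    (~ (step ≤-refl)) (~ (Inner.on V (m≤n+m _ 1) down)) (~ (Inner.on V ≤-refl same)) (~ (Outer.end U))
    (~ (step (m≤n+m _ 1)))
    (Outer.between U ≤-refl) u≁v (gap (2 + n) 0 ≤-refl) (≁-sym (Inner.off V (m≤n+m _ 2) (inj₂ ≤-refl)))
    (Outer.between U (m≤n+m _ 1)))

  -- A vertex v that misses both ends would be the third leaf of a claw at u beside p 0 and p k. At
  -- position 1 or k - 1, v sees one end, and u, v and that end form the triangle of a bull.
  outer≁between : ∀ {u v i} → suc i < k → Outer u → Inner v (suc i) → u ≁ v
  outer≁between {u} {v} {zero} _ U V u∼v = noBull (bull⇉ {b = u} {d = p 2} {e = p k}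
    (~ u∼v) (Outer.start U) (Inner.on V z≤n down) (Inner.on V (first 2) up) (Outer.end U)
    (≁-sym (Outer.between U (first 3))) (gap′ 0 0 (first 2)) (≁-sym (Inner.off V ≤-refl (inj₁ (first 3))))
    (≁-sym (skip (first 2) ≤-refl)) (skip (first 4) ≤-refl))
  outer≁between {u} {v} {suc i} i<k U V u∼v with m≤n⇒m<n∨m≡n i<k
  ... | inj₁ 3+i<k = noClaw (claw⇉ (Outer.start U) u∼v (Outer.end U)
    (≁-sym (Inner.off V z≤n (inj₂ (s≤s (s≤s z≤n))))) (skip (first 2) ≤-refl) (Inner.off V ≤-refl (inj₁ 3+i<k)))
  ... | inj₂ refl = noBull (bull⇉ {b = u} {d = p (2 + n)} {e = p 0}
    (~ u∼v) (Outer.end U) (Inner.on V ≤-refl up) (Inner.on V (m≤n+m _ 2) down) (Outer.start U)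
    (≁-sym (Outer.between U (m≤n+m _ 1))) (gap (2 + n) 0 ≤-refl)
    (≁-sym (Inner.off V z≤n (inj₂ (s≤s (s≤s z≤n))))) (skip (first 2) ≤-refl) (≁-sym (skip (first 2) (m≤n+m _ 2))))

  Isolated : V → Set
  Isolated v = ∀ {j} → j ≤ k → v ≁ p j

  -- This makes the path dominating in a connected graph. If u sees two non-adjacent path vertices,
  -- they and v are the leaves of a claw; otherwise u sits at an end position and v is a horn of a
  -- bull.
  kind≁isolated : ∀ {u v} → Kind u → Isolated v → u ≁ v
  kind≁isolated (outer U) V u∼v = noClaw (claw⇉ (Outer.start U) (Outer.end U) u∼v
    (skip (first 2) ≤-refl) (≁-sym (V z≤n)) (≁-sym (V ≤-refl)))
  kind≁isolated {u} {v} (inner {zero} U) V u∼v = noBull (bull⇉ {b = u} {d = p 2} {e = v}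
    (~ (Inner.on U (first 1) up)) (Inner.on U z≤n same) (~ (step (first 1))) (step (first 2)) u∼v
    (≁-sym (Inner.off U (first 2) (inj₁ ≤-refl))) (gap′ 0 0 (first 2)) (V (first 1)) (V z≤n) (≁-sym (V (first 2))))
  kind≁isolated {u} {v} (inner {suc i} U) V u∼v with m≤n⇒m<n∨m≡n (Inner.i≤k U)
  ... | inj₁ 2+i≤k = noClaw (claw⇉ (Inner.on U (below 2 2+i≤k) down) (Inner.on U 2+i≤k up) u∼v
    (gap i 0 2+i≤k) (≁-sym (V (below 2 2+i≤k))) (≁-sym (V 2+i≤k)))
  ... | inj₂ refl = noBull (bull⇉ {b = u} {d = p (2 + n)} {e = v}
    (~ (Inner.on U (m≤n+m _ 1) down)) (Inner.on U ≤-refl same) (step ≤-refl) (~ (step (m≤n+m _ 1))) u∼v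
    (≁-sym (Inner.off U (m≤n+m _ 2) (inj₂ ≤-refl))) (gap (2 + n) 0 ≤-refl) (V (m≤n+m _ 1)) (V ≤-refl)
    (≁-sym (V (m≤n+m _ 2))))

  inner-path : ∀ {i} → i ≤ k → Inner (p i) i
  inner-path i≤k = mkInner i≤k (near i≤k) (far i≤k)

  -- Some path vertex tells the two positions apart: the left neighbour of position i if there is
  -- one, and otherwise p 2 or p j.
  inner-≮ : ∀ {v i j} → Inner v i → Inner v j → ¬ (i < j)
  inner-≮ {i = zero} {1} U V _ = Inner.off U (first 2) (inj₁ ≤-refl) (Inner.on V (first 2) up)
  inner-≮ {i = zero} {suc (suc j)} U V _ =
    Inner.off U (Inner.i≤k V) (inj₁ (s≤s (s≤s z≤n))) (Inner.on V (Inner.i≤k V) same)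
  inner-≮ {i = suc i} U V i<j = Inner.off V i≤k (inj₂ i<j) (Inner.on U i≤k down)
    where i≤k = below 1 (Inner.i≤k U)

  inner-unique : ∀ {v i j} → Inner v i → Inner v j → i ≡ j
  inner-unique {i = i} {j} U V with <-cmp i j
  ... | tri< i<j _ _ = contradiction i<j (inner-≮ U V)
  ... | tri≈ _ i≡j _ = i≡j
  ... | tri> _ _ j<i = contradiction j<i (inner-≮ V U)

  inner-¬outer : ∀ {v i} → Inner v i → ¬ Outer v
  inner-¬outer {i = zero}        U O = Inner.off U ≤-refl (inj₁ (first 2)) (Outer.end O)
  inner-¬outer {i = suc zero}    U O = Inner.off U ≤-refl (inj₁ (first 3)) (Outer.end O)
  inner-¬outer {i = suc (suc _)} U O = Inner.off U z≤n (inj₂ (s≤s (s≤s z≤n))) (Outer.start O)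

  path-injective : ∀ {i j} → i ≤ k → j ≤ k → p i ≡ p j → i ≡ j
  path-injective i≤k j≤k pᵢ≡pⱼ =
    inner-unique (inner-path i≤k) (subst (λ v → Inner v _) (sym pᵢ≡pⱼ) (inner-path j≤k))

  module Maximal (noPendantˡ : ∀ v → ¬ Pendant G p k v)
                 (noPendantʳ : ∀ v → ¬ Pendant G (reverse k p) k v) where

    -- The absence of pendant vertices serves for a v that meets the path in a single end; all other
    -- patterns are settled by claws and bulls.
    classify : ∀ {v} → ∃[ j ] (j < suc k × v ∼ p j) → Kind v
    classify {v} (j , s≤s j≤k , v∼pⱼ)
      with anyUpTo? (λ i → (2 + i ≤? k) ×-dec ∼-dec G v (p i) ×-dec
                           ∼-dec G v (p (1 + i)) ×-dec ∼-dec G v (p (2 + i))) k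
    ... | yes (i , _ , i≤k , c₀ , c₁ , c₂) = inner (triple⇒inner i≤k c₀ c₁ c₂)
    ... | no ¬triple = cases
      where
      noTriple : ∀ {i} → 2 + i ≤ k → v ∼ p i → v ∼ p (1 + i) → v ≁ p (2 + i)
      noTriple i≤k c₀ c₁ c₂ = ¬triple (_ , below 1 i≤k , i≤k , c₀ , c₁ , c₂)

      ends : (∀ {j} → suc j < k → v ≁ p (suc j)) → Kind v
      ends ¬interior with ∼-dec G v (p 0) | ∼-dec G v (p k)
      ... | yes c₀ | yes cₖ = outer (mkOuter c₀ cₖ ¬interior)
      ... | _      | no ¬cₖ = ⊥-elim (noPendantˡ v (start j≤k v∼pⱼ , ¬later))
        where
        ¬later : ∀ {j} → suc j ≤ k → v ≁ p (suc j)
        ¬later 1+j≤k = [ ¬interior , (λ { refl → ¬cₖ }) ] (m≤n⇒m<n∨m≡n 1+j≤k)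

        start : ∀ {j} → j ≤ k → v ∼ p j → v ∼ p 0
        start {zero}  _     c = c
        start {suc j} 1+j≤k c = contradiction c (¬later 1+j≤k)
      -- `reverse k p (suc i)` is `p (3 + n ∸ i)`, whose index stays below k.
      ... | no ¬c₀ | yes cₖ = ⊥-elim (noPendantʳ v (cₖ , λ {i} i<k → ¬earlier (m∸n≤m (3 + n) i)))
        where
        ¬earlier : ∀ {j} → j ≤ 3 + n → v ≁ p j
        ¬earlier {zero}  _       = ¬c₀
        ¬earlier {suc j} 1+j≤3+n = ¬interior (s≤s 1+j≤3+n)

      cases : Kind v
      cases with ∼-dec G v (p 0) ×-dec ∼-dec G v (p 1)
      ... | yes (c₀ , c₁) = inner (firstPair⇒inner noTriple c₀ c₁)
      ... | no ¬first with ∼-dec G v (p (3 + n)) ×-dec ∼-dec G v (p (4 + n))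
      ...   | yes (c₃ , c₄) = inner (lastPair⇒inner noTriple c₃ c₄)
      ...   | no ¬last = ends (noInterior noTriple ¬first ¬last)

-- Expansions of paths and cycles

NearEq : ℕ → ℕ → Set
NearEq i j = i ≡ j ⊎ (j ≡ suc i ⊎ i ≡ suc j)

Near⇒NearEq : ∀ {i j} → Near i j → NearEq i j
Near⇒NearEq same = inj₁ refl
Near⇒NearEq up   = inj₂ (inj₁ refl)
Near⇒NearEq down = inj₂ (inj₂ refl)

NearEq⇒Near : ∀ {i j} → NearEq i j → Near i j
NearEq⇒Near (inj₁ refl)        = same
NearEq⇒Near (inj₂ (inj₁ refl)) = up
NearEq⇒Near (inj₂ (inj₂ refl)) = down

path-∼⇒Near : ∀ k {i j} → path k ⊢ i ∼ j → Near (toℕ i) (toℕ j)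
path-∼⇒Near k (inj₁ refl)     = same
path-∼⇒Near k (inj₂ adjacent) = NearEq⇒Near (inj₂ adjacent)

Near⇒path-∼ : ∀ k {i j} → Near (toℕ i) (toℕ j) → path k ⊢ i ∼ j
Near⇒path-∼ k near with Near⇒NearEq near
... | inj₁ i≡j      = inj₁ (Fin.toℕ-injective i≡j)
... | inj₂ adjacent = inj₂ adjacent

-- Repeats on numbers the relation that `cycle` symmetrises and keeps local.
Arc : ℕ → ℕ → ℕ → Set
Arc k i j = j ≡ suc i ⊎ (suc i ≡ k × j ≡ 0)

arc-functional : ∀ {k i j l} → j < k → l < k → Arc k i j → Arc k i l → j ≡ l
arc-functional j<k l<k (inj₁ refl)       (inj₁ refl)       = refl
arc-functional j<k l<k (inj₁ refl)       (inj₂ (refl , _)) = contradiction j<k (<-irrefl refl)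
arc-functional j<k l<k (inj₂ (refl , _)) (inj₁ refl)       = contradiction l<k (<-irrefl refl)
arc-functional j<k l<k (inj₂ (_ , refl)) (inj₂ (_ , refl)) = refl

arc-injective : ∀ {k i j l} → Arc k i l → Arc k j l → i ≡ j
arc-injective (inj₁ refl)          (inj₁ refl)       = refl
arc-injective (inj₂ (refl , _))    (inj₂ (refl , _)) = refl
arc-injective (inj₁ refl)          (inj₂ (_ , ()))
arc-injective (inj₂ (_ , refl))    (inj₁ ())

-- The sharp bound is 2; 3 agrees with `arc-3cycle`, so that `4 ≤ k` excludes both.
arc-2cycle : ∀ {k i j} → Arc k i j → Arc k j i → k ≤ 3
arc-2cycle (inj₁ refl)          (inj₁ ())
arc-2cycle (inj₁ refl)          (inj₂ (refl , refl)) = s≤s (s≤s z≤n)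
arc-2cycle (inj₂ (refl , refl)) (inj₁ refl)          = s≤s (s≤s z≤n)
arc-2cycle (inj₂ (refl , refl)) (inj₂ (refl , _))    = s≤s z≤n

arc-3cycle : ∀ {k i j l} → Arc k i j → Arc k j l → Arc k l i → k ≤ 3
arc-3cycle (inj₁ refl)          (inj₁ refl)          (inj₁ ())
arc-3cycle (inj₁ refl)          (inj₁ refl)          (inj₂ (refl , refl)) = ≤-refl
arc-3cycle (inj₁ refl)          (inj₂ (refl , refl)) (inj₁ refl)          = ≤-refl
arc-3cycle (inj₁ refl)          (inj₂ (refl , refl)) (inj₂ (() , _))
arc-3cycle (inj₂ (refl , refl)) (inj₁ refl)          (inj₁ refl)          = ≤-refl
arc-3cycle (inj₂ (refl , refl)) (inj₂ (refl , _))    _                    = s≤s z≤n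
arc-3cycle (inj₂ (refl , refl)) (inj₁ refl)          (inj₂ (refl , ()))

-- What paths and cycles of length at least four share. At the centre of a claw two of three spokes
-- point the same way, which identifies two leaves; the triangle of a bull would have to be a
-- directed cycle.
record ThinlyOriented (F : Graph) : Set₁ where
  field
    _⟶_        : Rel (Vertex F) 0ℓ
    orient     : ∀ {u v} → Adj F u v → u ⟶ v ⊎ v ⟶ u
    functional : ∀ {u v w} → u ⟶ v → u ⟶ w → v ≡ w
    injective  : ∀ {u v w} → u ⟶ w → v ⟶ w → u ≡ v
    no3cycle   : ∀ {u v w} → u ⟶ v → v ⟶ w → ¬ (w ⟶ u)

  clawFree : ¬ (claw ⇉ F)
  clawFree f = clash (orient (spoke 1F 2F)) (orient (spoke 2F 3F)) (orient (spoke 3F 1F))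
    where
    open _⇉_ f
    c = fun 0F

    -- `f` yields only `∼`; a second leaf j, related to the centre but not to leaf i, shows that the
    -- spoke is a genuine edge.
    spoke : ∀ i j → {True (∼-dec claw 0F i)} → {True (∼-dec claw 0F j)} → {False (∼-dec claw i j)} →
            Adj F c (fun i)
    spoke i j {0∼i} {0∼j} {i≁j} = ∼⇒Adj F
      (λ c≡fi → far i j {i≁j} (subst (λ x → F ⊢ x ∼ fun j) c≡fi (near 0F j {0∼j}))) (near 0F i {0∼i})

    clash : (c ⟶ fun 1F ⊎ fun 1F ⟶ c) → (c ⟶ fun 2F ⊎ fun 2F ⟶ c) → (c ⟶ fun 3F ⊎ fun 3F ⟶ c) → Empty.⊥
    clash (inj₁ r) (inj₁ s) _        = far 1F 2F (inj₁ (functional r s))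
    clash (inj₂ r) (inj₂ s) _        = far 1F 2F (inj₁ (injective r s))
    clash (inj₁ r) (inj₂ s) (inj₁ t) = far 1F 3F (inj₁ (functional r t))
    clash (inj₁ r) (inj₂ s) (inj₂ t) = far 2F 3F (inj₁ (injective s t))
    clash (inj₂ r) (inj₁ s) (inj₁ t) = far 2F 3F (inj₁ (functional s t))
    clash (inj₂ r) (inj₁ s) (inj₂ t) = far 1F 3F (inj₁ (injective r t))

  bullFree : ¬ (bull ⇉ F)
  bullFree f = noTriangle (orient (edge 0F 1F 3F)) (orient (edge 1F 2F 4F)) (orient (edge 0F 2F 3F))
    where
    open _⇉_ f

    distinct : ∀ i j l → {True (∼-dec bull i l)} → {False (∼-dec bull j l)} → fun i ≢ fun j
    distinct i j l {i∼l} {j≁l} fi≡fj =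
      far j l {j≁l} (subst (λ x → F ⊢ x ∼ fun l) fi≡fj (near i l {i∼l}))

    edge : ∀ i j l → {True (∼-dec bull i j)} → {True (∼-dec bull i l)} → {False (∼-dec bull j l)} →
           Adj F (fun i) (fun j)
    edge i j l {i∼j} {i∼l} {j≁l} = ∼⇒Adj F (distinct i j l {i∼l} {j≁l}) (near i j {i∼j})

    noTriangle : fun 0F ⟶ fun 1F ⊎ fun 1F ⟶ fun 0F → fun 1F ⟶ fun 2F ⊎ fun 2F ⟶ fun 1F →
                 fun 0F ⟶ fun 2F ⊎ fun 2F ⟶ fun 0F → Empty.⊥
    noTriangle (inj₁ r) (inj₁ s) (inj₁ t) = distinct 1F 2F 4F (functional r t)
    noTriangle (inj₁ r) (inj₁ s) (inj₂ t) = no3cycle r s t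
    noTriangle (inj₁ r) (inj₂ s) _        = distinct 0F 2F 3F (injective r s)
    noTriangle (inj₂ r) (inj₁ s) _        = distinct 0F 2F 3F (functional r s)
    noTriangle (inj₂ r) (inj₂ s) (inj₁ t) = no3cycle t s r
    noTriangle (inj₂ r) (inj₂ s) (inj₂ t) = distinct 1F 2F 4F (injective r t)

  expansion-clawBullFree : ∀ {G} → IsExpansionOf F G → ClawBullFree G
  expansion-clawBullFree ex =
    (λ h → clawFree (expansion⇒⇉ ex ⇉∘ HasInduced⇒⇉ h)) , (λ h → bullFree (expansion⇒⇉ ex ⇉∘ HasInduced⇒⇉ h))

path-thinlyOriented : ∀ k → ThinlyOriented (path k)
path-thinlyOriented k = record
  { _⟶_        = λ i j → toℕ j ≡ suc (toℕ i)
  ; orient     = id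
  ; functional = λ r s → Fin.toℕ-injective (trans r (sym s))
  ; injective  = λ r s → Fin.toℕ-injective (suc-injective (trans (sym r) s))
  ; no3cycle   = λ r s t → no3 r s t
  }
  where
  no3 : ∀ {a b c} → b ≡ suc a → c ≡ suc b → ¬ (a ≡ suc c)
  no3 refl refl ()

cycle-thinlyOriented : ∀ k 3≤k → 4 ≤ k → ThinlyOriented (cycle k 3≤k)
cycle-thinlyOriented k 3≤k 4≤k = record
  { _⟶_        = λ i j → Arc k (toℕ i) (toℕ j)
  ; orient     = id
  ; functional = λ {u} {v} {w} r s → Fin.toℕ-injective (arc-functional (Fin.toℕ<n v) (Fin.toℕ<n w) r s)
  ; injective  = λ r s → Fin.toℕ-injective (arc-injective r s)
  ; no3cycle   = λ r s t → contradiction (≤-trans 4≤k (arc-3cycle r s t)) 1+n≰n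
  }

cycle-successor : ∀ {k} (i : Fin k) → ∃[ j ] Arc k (toℕ i) (toℕ {k} j)
cycle-successor {suc k} i with m≤n⇒m<n∨m≡n (Fin.toℕ<n i)
... | inj₁ 1+i<k = fromℕ< 1+i<k , inj₁ (Fin.toℕ-fromℕ< 1+i<k)
... | inj₂ 1+i≡k = 0F , inj₂ (1+i≡k , refl)

cycle-predecessor : ∀ {k} (i : Fin k) → ∃[ j ] Arc k (toℕ {k} j) (toℕ i)
cycle-predecessor {suc k} zero    = fromℕ< (n<1+n k) , inj₂ (cong suc (Fin.toℕ-fromℕ< (n<1+n k)) , refl)
cycle-predecessor {suc k} (suc i) = inject₁ i , inj₁ (cong suc (sym (Fin.toℕ-inject₁ i)))

-- Infinite descent: of two neighbours on the cycle that are not adjacent to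
-- each other, one lies strictly further to the left on the path.
cycle-⇉̸-path : ∀ k 3≤k → 4 ≤ k → ∀ l → ¬ (cycle k 3≤k ⇉ path l)
cycle-⇉̸-path k 3≤k 4≤k l f = descend _ (fromℕ< (≤-trans (s≤s z≤n) 3≤k)) refl
  where
  open _⇉_ f

  lower : ∀ {x a b} → Near x a → Near x b → ¬ Near a b → a < x ⊎ b < x
  lower same near ¬near = contradiction near ¬near
  lower up   same ¬near = contradiction down ¬near
  lower up   up   ¬near = contradiction same ¬near
  lower down _    _     = inj₁ ≤-refl
  lower up   down _     = inj₂ ≤-refl

  descend : ∀ m (i : Fin k) → toℕ (fun i) ≡ m → Empty.⊥
  descend = <-rec _ λ { m rec i refl → step i rec }
    where
    step : ∀ i → (∀ {m} → m < toℕ (fun i) → ∀ j → toℕ (fun j) ≡ m → Empty.⊥) → Empty.⊥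
    step i rec with cycle-successor i | cycle-predecessor i
    ... | s , i⟶s | t , t⟶i =
      [ (λ s<i → rec s<i s refl) , (λ t<i → rec t<i t refl) ]
      (lower (path-∼⇒Near l (preserve (inj₂ (inj₁ i⟶s)))) (path-∼⇒Near l (preserve (inj₂ (inj₂ t⟶i))))
             (s≁t ∘ reflect ∘ Near⇒path-∼ l))
      where
      short : ¬ (k ≤ 3)
      short k≤3 = 1+n≰n (≤-trans 4≤k k≤3)

      s≁t : cycle k 3≤k ⊢ s ≁ t
      s≁t (inj₁ refl)       = short (arc-2cycle i⟶s t⟶i)
      s≁t (inj₂ (inj₁ s⟶t)) = short (arc-3cycle i⟶s s⟶t t⟶i)
      s≁t (inj₂ (inj₂ t⟶s)) = Graph.adj-irrefl (cycle k 3≤k)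
        (Fin.toℕ-injective (arc-functional (Fin.toℕ<n i) (Fin.toℕ<n s) t⟶i t⟶s)) (inj₁ i⟶s)

3K₁⇉path : ∀ {k} → 4 ≤ k → 3K₁ ⇉ path k
3K₁⇉path (s≤s (s≤s (s≤s (s≤s _)))) = 3K₁⇉ {a = 0F} {2F} {4F}
  (λ { (inj₁ ()) ; (inj₂ (inj₁ ())) ; (inj₂ (inj₂ ())) })
  (λ { (inj₁ ()) ; (inj₂ (inj₁ ())) ; (inj₂ (inj₂ ())) })
  (λ { (inj₁ ()) ; (inj₂ (inj₁ ())) ; (inj₂ (inj₂ ())) })

-- Vertices 4 and 0 are non-adjacent because vertex 5 separates them, which a cycle of length five
-- would not allow.
3K₁⇉cycle : ∀ {k} 3≤k → 6 ≤ k → 3K₁ ⇉ cycle k 3≤k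
3K₁⇉cycle _ (s≤s (s≤s (s≤s (s≤s (s≤s (s≤s _)))))) = 3K₁⇉ {a = 0F} {2F} {4F}
  (λ { (inj₁ ()) ; (inj₂ (inj₁ (inj₁ ()))) ; (inj₂ (inj₁ (inj₂ (() , _))))
                 ; (inj₂ (inj₂ (inj₁ ()))) ; (inj₂ (inj₂ (inj₂ (() , _)))) })
  (λ { (inj₁ ()) ; (inj₂ (inj₁ (inj₁ ()))) ; (inj₂ (inj₁ (inj₂ (() , _))))
                 ; (inj₂ (inj₂ (inj₁ ()))) ; (inj₂ (inj₂ (inj₂ (() , _)))) })
  (λ { (inj₁ ()) ; (inj₂ (inj₁ (inj₁ ()))) ; (inj₂ (inj₁ (inj₂ (() , _))))
                 ; (inj₂ (inj₂ (inj₁ ()))) ; (inj₂ (inj₂ (inj₂ (() , _)))) })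

-- From an independent triple to a maximal induced path

crossing : ∀ G {P : Pred (Vertex G) 0ℓ} → Decidable P → ∀ {u v} → Star (Adj G) u v → P u → ¬ P v →
           ∃[ x ] ∃[ y ] (P x × ¬ P y × G ⊢ x ∼ y)
crossing G P? ε Pu ¬Pv = contradiction Pu ¬Pv
crossing G P? (_◅_ {j = w} u~w w⋯v) Pu ¬Pv with P? w
... | yes Pw = crossing G P? w⋯v Pw ¬Pv
... | no ¬Pw = _ , _ , Pu , ¬Pw , inj₂ u~w

module _ {G : Graph} (noClaw : ¬ (claw ⇉ G)) (noBull : ¬ (bull ⇉ G)) (connected : Connected G) where

  private
    infix 4 _∼_ _≁_
    _∼_ = G ⊢_∼_
    _≁_ = G ⊢_≁_

    V : Set
    V = Vertex G

    ~ : ∀ {u v} → u ∼ v → v ∼ u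
    ~ = ∼-sym G

    ≁-sym : ∀ {u v} → u ≁ v → v ≁ u
    ≁-sym u≁v = u≁v ∘ ~

    walk : ∀ u v → Star (Adj G) u v
    walk = proj₂ connected

  record P₃+K₁ : Set where
    constructor mkP₃+K₁
    field
      {a b c d} : V
      a∼b : a ∼ b
      b∼c : b ∼ c
      a≁c : a ≁ c
      d≁a : d ≁ a
      d≁b : d ≁ b
      d≁c : d ≁ c

  -- A walk starting at the member a of the triple leaves the closed neighbourhood of a along an
  -- edge xy. If x sees both other members, or x neither and y both, there is a claw. Otherwise a, x
  -- and the member seen by x, or a, x, y, form the path, and a remaining member is isolated from
  -- it.
  3K₁⇒P₃+K₁ : 3K₁ ⇉ G → P₃+K₁
  3K₁⇒P₃+K₁ f with crossing G (∼-dec G (fun 0F)) (walk (fun 0F) (fun 1F)) (inj₁ refl) (far 0F 1F)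
    where open _⇉_ f
  ... | x , y , a∼x , a≁y , x∼y = result (∼-dec G x b) (∼-dec G x c) (∼-dec G y b) (∼-dec G y c)
    where
    open _⇉_ f
    b = fun 1F
    c = fun 2F

    result : Dec (x ∼ b) → Dec (x ∼ c) → Dec (y ∼ b) → Dec (y ∼ c) → P₃+K₁
    result (yes x∼b) (yes x∼c) _ _ =
      ⊥-elim (noClaw (claw⇉ (~ a∼x) x∼b x∼c (far 0F 1F) (far 0F 2F) (far 1F 2F)))
    result (yes x∼b) (no x≁c)  _ _ = mkP₃+K₁ a∼x x∼b (far 0F 1F) (far 2F 0F) (≁-sym x≁c) (far 2F 1F)
    result (no x≁b)  (yes x∼c) _ _ = mkP₃+K₁ a∼x x∼c (far 0F 2F) (far 1F 0F) (≁-sym x≁b) (far 1F 2F)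
    result (no x≁b)  (no x≁c) (yes y∼b) (yes y∼c) =
      ⊥-elim (noClaw (claw⇉ (~ x∼y) y∼b y∼c x≁b x≁c (far 1F 2F)))
    result (no x≁b)  (no x≁c) (no y≁b)  _         = mkP₃+K₁ a∼x x∼y a≁y (far 1F 0F) (≁-sym x≁b) (≁-sym y≁b)
    result (no x≁b)  (no x≁c) (yes _)   (no y≁c)  = mkP₃+K₁ a∼x x∼y a≁y (far 2F 0F) (≁-sym x≁c) (≁-sym y≁c)

  fiveVertexPath : ∀ {a b c d e} → a ∼ b → b ∼ c → c ∼ d → d ∼ e →
                   a ≁ c → a ≁ d → a ≁ e → b ≁ d → b ≁ e → c ≁ e → ∃[ p ] InducedPath G p 4
  fiveVertexPath {a} {b} {c} {d} {e} ab bc cd de ac ad ae bd be ce =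
    -- The constant sequence at e is the one-vertex path; only its entry at 0 is within range.
    _ , prepend-inducedPath (prepend-inducedPath (prepend-inducedPath (prepend-inducedPath {p = λ _ → e} single
      (de , λ ()))
      (cd , λ { {0} _ → ce ; {suc _} (s≤s ()) }))
      (bc , λ { {0} _ → bd ; {1} _ → be ; {suc (suc _)} (s≤s (s≤s ())) }))
      (ab , λ { {0} _ → ac ; {1} _ → ad ; {2} _ → ae ; {suc (suc (suc _))} (s≤s (s≤s (s≤s ()))) })
    where
    single : InducedPath G (λ _ → e) 0
    single = record { step = λ () ; skip = λ { () z≤n } }

  -- A walk from a to d leaves the closed neighbourhood of the path a, b, c along an edge yx. Claws
  -- and bulls leave only the case that y sees one end and nothing else of the path, and then x, y
  -- prolong it there.
  P₃+K₁⇒path : P₃+K₁ → ∃[ p ] InducedPath G p 4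
  P₃+K₁⇒path (mkP₃+K₁ {a} {b} {c} {d} a∼b b∼c a≁c d≁a d≁b d≁c)
    with crossing G {P = λ z → z ∼ a ⊎ z ∼ b ⊎ z ∼ c}
                    (λ z → ∼-dec G z a ⊎-dec ∼-dec G z b ⊎-dec ∼-dec G z c)
                    (walk a d)
                  (inj₁ (inj₁ refl)) [ d≁a , [ d≁b , d≁c ] ]
  ... | y , x , y-near , x-far , y∼x = result (∼-dec G y a) (∼-dec G y b) (∼-dec G y c)
    where
    x≁a : x ≁ a
    x≁a = x-far ∘ inj₁
    x≁b : x ≁ b
    x≁b = x-far ∘ inj₂ ∘ inj₁
    x≁c : x ≁ c
    x≁c = x-far ∘ inj₂ ∘ inj₂

    result : Dec (y ∼ a) → Dec (y ∼ b) → Dec (y ∼ c) → ∃[ p ] InducedPath G p 4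
    result (yes y∼a) _ (yes y∼c) = ⊥-elim (noClaw (claw⇉ y∼a y∼c y∼x a≁c (≁-sym x≁a) (≁-sym x≁c)))
    result (yes y∼a) (yes y∼b) (no y≁c) = ⊥-elim (noBull (bull⇉ {c = a} {d = x} {e = c}
      y∼b (~ a∼b) y∼a y∼x b∼c x≁b x≁a (≁-sym y≁c) (≁-sym a≁c) x≁c))
    result (yes y∼a) (no y≁b) (no y≁c) =
      fiveVertexPath (~ y∼x) y∼a a∼b b∼c x≁a x≁b x≁c y≁b y≁c a≁c
    result (no y≁a) (yes y∼b) (yes y∼c) = ⊥-elim (noBull (bull⇉ {c = c} {d = x} {e = a}
      y∼b b∼c y∼c y∼x (~ a∼b) x≁b x≁c (≁-sym y≁a) a≁c x≁a))
    result (no y≁a) (no y≁b) (yes y∼c) =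
      fiveVertexPath (~ y∼x) y∼c (~ b∼c) (~ a∼b) x≁c x≁b x≁a y≁b y≁a (≁-sym a≁c)
    result (no y≁a) (yes y∼b) (no y≁c) = ⊥-elim (noClaw (claw⇉ (~ a∼b) b∼c (~ y∼b) a≁c (≁-sym y≁a) (≁-sym y≁c)))
    result (no y≁a) (no y≁b) (no y≁c) = ⊥-elim ([ y≁a , [ y≁b , y≁c ] ] y-near)

  record MaximalPath : Set where
    field
      {n}  : ℕ
      {p}  : ℕ → V
      isInducedPath : InducedPath G p (4 + n)
      noPendantˡ : ∀ v → ¬ Pendant G p (4 + n) v
      noPendantʳ : ∀ v → ¬ Pendant G (reverse (4 + n) p) (4 + n) v

  -- Induced paths of this length are injective, so 5 + n never exceeds the order; each prolongation
  -- trades one unit of fuel for one of n. Prolonging on the right means reversing and then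
  -- prepending.
  extend : ∀ fuel {n p} → Graph.order G ≤ fuel + n → InducedPath G p (4 + n) → MaximalPath
  extend zero {n} {p} order≤n P = contradiction (≤-trans (m≤n+m (suc n) 4) (≤-trans 5+n≤order order≤n)) 1+n≰n
    where
    open Along noClaw noBull P
    5+n≤order : 5 + n ≤ Graph.order G
    5+n≤order = Fin.injective⇒≤ {f = p ∘ toℕ} λ {i} {j} pᵢ≡pⱼ →
      Fin.toℕ-injective (path-injective (<⇒≤pred (Fin.toℕ<n i)) (<⇒≤pred (Fin.toℕ<n j)) pᵢ≡pⱼ)
  extend (suc fuel) {n} {p} order≤ P
    with Fin.any? (pendant? G p (4 + n)) | Fin.any? (pendant? G (reverse (4 + n) p) (4 + n))
  ... | yes (v , pendant) | _ =
    extend fuel (subst (Graph.order G ≤_) (sym (+-suc fuel n)) order≤) (prepend-inducedPath P pendant)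
  ... | no _ | yes (v , pendant) =
    extend fuel (subst (Graph.order G ≤_) (sym (+-suc fuel n)) order≤)
      (prepend-inducedPath (reverse-inducedPath P) pendant)
  ... | no ¬l | no ¬r = record { isInducedPath = P ; noPendantˡ = curry ¬l ; noPendantʳ = curry ¬r }

  -- Bags read off from a maximal path

  module FromMaximalPath (maximal : MaximalPath) where
    open MaximalPath maximal
    open Along noClaw noBull isInducedPath
    open Maximal noPendantˡ noPendantʳ

    private
      k : ℕ
      k = 4 + n

    Meets : V → Set
    Meets v = ∃[ j ] (j < suc k × v ∼ p j)

    meets? : Decidable Meets
    meets? v = anyUpTo? (λ j → ∼-dec G v (p j)) (suc k)

    -- A vertex missing the path would, on a walk from p 0, produce an edge excluded by
    -- `kind≁isolated`.
    kind : ∀ v → Kind v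
    kind v with meets? v
    ... | yes meets = classify meets
    ... | no misses with crossing G meets? (walk (p 0) v) (0 , s≤s z≤n , inj₁ refl) misses
    ...   | x , y , x-meets , y-misses , x∼y =
      contradiction x∼y (kind≁isolated (classify x-meets) (λ j≤k y∼pⱼ → y-misses (_ , s≤s j≤k , y∼pⱼ)))

    inner-Near⇒∼ : ∀ {u v i j} → Inner u i → Inner v j → Near i j → u ∼ v
    inner-Near⇒∼ U V same = inner∼inner U V
    inner-Near⇒∼ U V up   = inner∼innerʳ U V
    inner-Near⇒∼ U V down = ~ (inner∼innerʳ V U)

    inner-∼⇒Near : ∀ {u v i j} → Inner u i → Inner v j → u ∼ v → Near i j
    inner-∼⇒Near {i = i} {j} U V u∼v with near-or-far i j
    ... | inj₁ near       = near
    ... | inj₂ (inj₁ i<j) = contradiction u∼v (inner≁inner i<j U V)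
    ... | inj₂ (inj₂ j<i) = contradiction (~ u∼v) (inner≁inner j<i V U)

    module AllInner (noOuter : ∀ v → ¬ Outer v) where

      innerOf : ∀ v → ∃[ i ] Inner v i
      innerOf v with kind v
      ... | inner V = _ , V
      ... | outer V = contradiction V (noOuter v)

      bound : ∀ v → proj₁ (innerOf v) < suc k
      bound v = s≤s (Inner.i≤k (proj₂ (innerOf v)))

      bag : V → Fin (suc k)
      bag v = fromℕ< (bound v)

      toℕ-bag : ∀ v → toℕ (bag v) ≡ proj₁ (innerOf v)
      toℕ-bag v = Fin.toℕ-fromℕ< (bound v)

      bag⇉ : G ⇉ path k
      bag⇉ = mk⇉ bag
        (λ {u} {v} u∼v → Near⇒path-∼ k (subst₂ Near (sym (toℕ-bag u)) (sym (toℕ-bag v))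
          (inner-∼⇒Near (proj₂ (innerOf u)) (proj₂ (innerOf v)) u∼v)))
        (λ {u} {v} bu∼bv → inner-Near⇒∼ (proj₂ (innerOf u)) (proj₂ (innerOf v))
          (subst₂ Near (toℕ-bag u) (toℕ-bag v) (path-∼⇒Near k bu∼bv)))

      expansion : IsExpansionOf (path k) G
      expansion = ⇉⇒expansion bag⇉ λ i → p (toℕ i) , Fin.toℕ-injective
        (trans (toℕ-bag (p (toℕ i)))
               (inner-unique (proj₂ (innerOf (p (toℕ i)))) (inner-path (<⇒≤pred (Fin.toℕ<n i)))))

    module SomeOuter {w : V} (W : Outer w) (3≤6+n : 3 ≤ 6 + n) where

      CycleNear : ℕ → ℕ → Set
      CycleNear i j = i ≡ j ⊎ (Arc (6 + n) i j ⊎ Arc (6 + n) j i)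

      label : ∀ {v} → Kind v → ℕ
      label (inner {i} _) = i
      label (outer _)     = 5 + n

      label< : ∀ {v} (V : Kind v) → label V < 6 + n
      label< (inner V) = s≤s (m≤n⇒m≤1+n (Inner.i≤k V))
      label< (outer _) = ≤-refl

      ∼⇒CycleNear : ∀ {u v} (U : Kind u) (V : Kind v) → u ∼ v → CycleNear (label U) (label V)
      ∼⇒CycleNear (inner U) (inner V) u∼v with inner-∼⇒Near U V u∼v
      ... | same = inj₁ refl
      ... | up   = inj₂ (inj₁ (inj₁ refl))
      ... | down = inj₂ (inj₂ (inj₁ refl))
      ∼⇒CycleNear (outer U) (outer V) u∼v = inj₁ refl
      ∼⇒CycleNear (outer U) (inner V) u∼v = outer-inner U V u∼v
        where
        outer-inner : ∀ {u v i} → Outer u → Inner v i → u ∼ v → CycleNear (5 + n) i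
        outer-inner {i = zero}  U V u∼v = inj₂ (inj₁ (inj₂ (refl , refl)))
        outer-inner {i = suc i} U V u∼v with m≤n⇒m<n∨m≡n (Inner.i≤k V)
        ... | inj₁ 1+i<k = contradiction u∼v (outer≁between 1+i<k U V)
        ... | inj₂ refl  = inj₂ (inj₂ (inj₁ refl))
      ∼⇒CycleNear (inner U) (outer V) u∼v with ∼⇒CycleNear (outer V) (inner U) (~ u∼v)
      ... | inj₁ eq       = inj₁ (sym eq)
      ... | inj₂ (inj₁ r) = inj₂ (inj₂ r)
      ... | inj₂ (inj₂ r) = inj₂ (inj₁ r)

      outer-inner-∼ : ∀ {u v i} → Outer u → Inner v i → CycleNear (5 + n) i → u ∼ v
      outer-inner-∼ U V (inj₁ refl)                     = contradiction (Inner.i≤k V) 1+n≰n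
      outer-inner-∼ U V (inj₂ (inj₁ (inj₁ refl)))       = contradiction (≤-trans (m≤n+m _ 1) (Inner.i≤k V)) 1+n≰n
      outer-inner-∼ U V (inj₂ (inj₁ (inj₂ (_ , refl)))) = outer∼first U V
      outer-inner-∼ U V (inj₂ (inj₂ (inj₁ refl)))       = outer∼last U V
      outer-inner-∼ U V (inj₂ (inj₂ (inj₂ (_ , ()))))

      CycleNear⇒∼ : ∀ {u v} (U : Kind u) (V : Kind v) → CycleNear (label U) (label V) → u ∼ v
      CycleNear⇒∼ (outer U) (outer V) _ = outer∼outer U V
      CycleNear⇒∼ (outer U) (inner V) near = outer-inner-∼ U V near
      CycleNear⇒∼ (inner U) (outer V) (inj₁ eq)       = ~ (outer-inner-∼ V U (inj₁ (sym eq)))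
      CycleNear⇒∼ (inner U) (outer V) (inj₂ (inj₁ r)) = ~ (outer-inner-∼ V U (inj₂ (inj₂ r)))
      CycleNear⇒∼ (inner U) (outer V) (inj₂ (inj₂ r)) = ~ (outer-inner-∼ V U (inj₂ (inj₁ r)))
      CycleNear⇒∼ (inner U) (inner V) (inj₁ refl)               = inner∼inner U V
      CycleNear⇒∼ (inner U) (inner V) (inj₂ (inj₁ (inj₁ refl))) = inner∼innerʳ U V
      CycleNear⇒∼ (inner U) (inner V) (inj₂ (inj₂ (inj₁ refl))) = ~ (inner∼innerʳ V U)
      CycleNear⇒∼ (inner U) (inner V) (inj₂ (inj₁ (inj₂ (refl , _)))) = contradiction (Inner.i≤k U) 1+n≰n
      CycleNear⇒∼ (inner U) (inner V) (inj₂ (inj₂ (inj₂ (refl , _)))) = contradiction (Inner.i≤k V) 1+n≰n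

      bag : V → Fin (6 + n)
      bag v = fromℕ< (label< (kind v))

      toℕ-bag : ∀ v → toℕ (bag v) ≡ label (kind v)
      toℕ-bag v = Fin.toℕ-fromℕ< (label< (kind v))

      bag⇉ : G ⇉ cycle (6 + n) 3≤6+n
      bag⇉ = mk⇉ bag
        (λ {u} {v} u∼v → from (subst₂ CycleNear (sym (toℕ-bag u)) (sym (toℕ-bag v))
          (∼⇒CycleNear (kind u) (kind v) u∼v)))
        (λ {u} {v} bu∼bv → CycleNear⇒∼ (kind u) (kind v)
          (subst₂ CycleNear (toℕ-bag u) (toℕ-bag v) (to bu∼bv)))
        where
        from : ∀ {i j} → CycleNear (toℕ i) (toℕ j) → cycle (6 + n) 3≤6+n ⊢ i ∼ j
        from = [ inj₁ ∘ Fin.toℕ-injective , inj₂ ]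
        to : ∀ {i j} → cycle (6 + n) 3≤6+n ⊢ i ∼ j → CycleNear (toℕ i) (toℕ j)
        to = [ inj₁ ∘ cong toℕ , inj₂ ]

      label-inner : ∀ {v i} (V : Kind v) → Inner v i → label V ≡ i
      label-inner (inner V) V′ = inner-unique V V′
      label-inner (outer V) V′ = contradiction V (inner-¬outer V′)

      label-outer : ∀ {v} (V : Kind v) → Outer v → label V ≡ 5 + n
      label-outer (inner V) V′ = contradiction V′ (inner-¬outer V)
      label-outer (outer V) V′ = refl

      expansion : IsExpansionOf (cycle (6 + n) 3≤6+n) G
      expansion = ⇉⇒expansion bag⇉ nonempty
        where
        nonempty : ∀ i → ∃[ v ] bag v ≡ i
        nonempty i with m<1+n⇒m<n∨m≡n (Fin.toℕ<n i)
        ... | inj₁ i<5+n = p (toℕ i) , Fin.toℕ-injective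
          (trans (toℕ-bag (p (toℕ i))) (label-inner (kind (p (toℕ i))) (inner-path (<⇒≤pred i<5+n))))
        -- The given outer vertex fills the bag that closes the cycle.
        ... | inj₂ i≡5+n = w , Fin.toℕ-injective (trans (toℕ-bag w)
          (trans (label-outer (kind w) W) (sym i≡5+n)))

    outer? : ∀ v → Dec (Outer v)
    outer? v with kind v
    ... | inner V = no (inner-¬outer V)
    ... | outer V = yes V

    pathOrCycle : (ExpansionOfLongPath ∪ ExpansionOfLongCycle) G
    pathOrCycle with Fin.any? outer?
    -- This proof of `3 ≤ 6 + n` is the one built into `ExpansionOfLongCycle`, so both mention the
    -- same cycle.
    ... | yes (_ , W) = inj₂ (6 + n , m≤m+n 6 n , SomeOuter.expansion W (≤-trans (m≤m+n 3 3) (m≤m+n 6 n)))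
    ... | no ¬outer   = inj₁ (4 + n , m≤m+n 4 n , AllInner.expansion (λ v V → ¬outer (v , V)))

  3K₁⇒pathOrCycle : 3K₁ ⇉ G → (ExpansionOfLongPath ∪ ExpansionOfLongCycle) G
  3K₁⇒pathOrCycle f = FromMaximalPath.pathOrCycle
    (extend (Graph.order G) (m≤m+n _ 0) (proj₂ (P₃+K₁⇒path (3K₁⇒P₃+K₁ f))))

-- The equivalence and the disjointness of the classes

3K₁? : ∀ G → Dec (3K₁ ⇉ G)
3K₁? G = map′ (λ (_ , _ , _ , ab , ac , bc) → 3K₁⇉ ab ac bc)
              (λ f → let open _⇉_ f in fun 0F , fun 1F , fun 2F , far 0F 1F , far 0F 2F , far 1F 2F)
              (Fin.any? λ a → Fin.any? λ b → Fin.any? λ c →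
                ¬? (∼-dec G a b) ×-dec ¬? (∼-dec G a c) ×-dec ¬? (∼-dec G b c))

clawBullFree⇒classes : ∀ {G} → Connected G → ClawBullFree G →
                       (ExpansionOfLongPath ∪ ExpansionOfLongCycle ∪ ConnectedCoTriangleFree) G
clawBullFree⇒classes {G} connected (noClaw , noBull) = cases (3K₁? G)
  where
  cases : Dec (3K₁ ⇉ G) → (ExpansionOfLongPath ∪ ExpansionOfLongCycle ∪ ConnectedCoTriangleFree) G
  cases (no ¬3K₁) = inj₂ (inj₂ (¬3K₁⇒coTriangleFree connected ¬3K₁))
  cases (yes f)   = map₂ inj₁ (3K₁⇒pathOrCycle (noClaw ∘ ⇉⇒claw) (noBull ∘ ⇉⇒bull) connected f)

-- The leaves of a claw are an independent triple, and so are the two horns of a bull with the third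
-- vertex of its triangle.
coTriangleFree-clawBullFree : ∀ {G} → ConnectedCoTriangleFree G → ClawBullFree G
coTriangleFree-clawBullFree {G} coTriangleFree =
    (λ h → let open _⇉_ (HasInduced⇒⇉ {claw} {G} h) in ¬3K₁ (3K₁⇉ {G} (far 1F 2F) (far 1F 3F) (far 2F 3F)))
  , (λ h → let open _⇉_ (HasInduced⇒⇉ {bull} {G} h) in ¬3K₁ (3K₁⇉ {G} (far 2F 3F) (far 2F 4F) (far 3F 4F)))
  where ¬3K₁ = coTriangleFree⇒¬3K₁ {G} coTriangleFree

classes⇒clawBullFree : ∀ {G} → (ExpansionOfLongPath ∪ ExpansionOfLongCycle ∪ ConnectedCoTriangleFree) G →
                       ClawBullFree G
classes⇒clawBullFree (inj₁ (k , _ , ex)) = ThinlyOriented.expansion-clawBullFree (path-thinlyOriented k) ex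
classes⇒clawBullFree (inj₂ (inj₁ (k , 6≤k , ex))) =
  ThinlyOriented.expansion-clawBullFree (cycle-thinlyOriented k (≤-trans (m≤m+n 3 3) 6≤k)
                                                                  (≤-trans (m≤n+m 4 2) 6≤k)) ex
classes⇒clawBullFree {G} (inj₂ (inj₂ coTriangleFree)) = coTriangleFree-clawBullFree {G} coTriangleFree

theorem1 : (∀ G → Connected G →
    ClawBullFree G ⇔ (ExpansionOfLongPath ∪ ExpansionOfLongCycle ∪ ConnectedCoTriangleFree) G)
    × (ExpansionOfLongPath ⊥ ExpansionOfLongCycle)
    × (ExpansionOfLongPath ⊥ ConnectedCoTriangleFree)
    × (ExpansionOfLongCycle ⊥ ConnectedCoTriangleFree)
theorem1 =
    (λ G connected → mk⇔ (clawBullFree⇒classes connected) classes⇒clawBullFree)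
  -- Picking a vertex from each cycle bag and reading off its path bag would map the cycle into the
  -- path.
  , (λ ((l , _ , isPath) , (k , 6≤k , isCycle)) →
       cycle-⇉̸-path k (≤-trans (m≤m+n 3 3) 6≤k) (≤-trans (m≤n+m 4 2) 6≤k) l
         (expansion⇒⇉ isPath ⇉∘ section⇉ isCycle))
  , (λ ((_ , 4≤k , isPath) , coTriangleFree) →
       coTriangleFree⇒¬3K₁ coTriangleFree (section⇉ isPath ⇉∘ 3K₁⇉path 4≤k))
  , (λ ((_ , 6≤k , isCycle) , coTriangleFree) →
       coTriangleFree⇒¬3K₁ coTriangleFree (section⇉ isCycle ⇉∘ 3K₁⇉cycle (≤-trans (m≤m+n 3 3) 6≤k) 6≤k))
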